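{- Let $n\ge2$. The type $B_n$ zeta map $\zeta_B:\mathcal L_{n,n}\to\mathcal B_{2n}$ is a bijection.
   Context: $\mathcal L_{n,n}$: words in $\{N,E\}$ with $n$ letters of each kind; $\mathcal B_{2n}$: words of length $2n$ all of whose prefixes have at least as many $N$'s as $E$'s. For $\pi\in\mathcal L_{n,n}$ let $\pi_i$ be the number of East steps before the $i$-th North step; set $\lambda_i=\pi_i$ for $i<n$ and $\lambda_n=2\pi_n-\pi_{n-1}$ if $\pi_1+\dots+\pi_{n-2}$ is even, $\lambda_n=2n+1-2\pi_n+\pi_{n-1}$ if odd. Type $B_n$ area vector: $\mu_i=\lambda_i-i$ for $i<n$, and $\mu_n=\lambda_n-n$ if $n\equiv0,3\pmod4$, $\mu_n=n+1-\lambda_n$ if $n\equiv1,2\pmod4$. For $a\in\mathbb Z^n$, $j\ge0$: $\overrightarrow{S}^+_j(a)$ reads $a$ left to right writing $N$ for entries $j$ and $E$ for entries $j+1$; $\overleftarrow{S}^+_j(a)$ reads right to left; $\overrightarrow{S}^-_j,\overleftarrow{S}^-_j$ likewise with $N$ for $-j$ and $E$ for $-j-1$. $\zeta_B(\pi)=\overleftarrow{S}^-_{2n}(\mu)\overrightarrow{S}^+_{2n}(\mu)\overleftarrow{S}^-_{2n-1}(\mu)\overrightarrow{S}^+_{2n-1}(\mu)\cdots\overleftarrow{S}^-_1(\mu)\overrightarrow{S}^+_1(\mu)\overleftarrow{S}^-_0(\mu)\big(N\overrightarrow{S}^+_0(\mu)\big)^\circ$, where $(\cdot)^\circ$ deletes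 the last letter. -}

module Defs where

open import Data.Bool using (Bool; true; false; if_then_else_; _∨_)
open import Data.Nat as ℕ using (ℕ; zero; suc; _≤_; _<ᵇ_; _≡ᵇ_; _%_)
open import Data.Integer as ℤ using (ℤ; +_; -_; _-_)
open import Data.List using (List; []; _∷_; _++_; map; reverse; take; length; upTo; concatMap)
open import Data.Nat.ListAction using (sum)
open import Data.Product using (_×_)
open import Relation.Nullary.Decidable using (⌊_⌋)
open import Relation.Binary.PropositionalEquality using (_≡_)

data Step : Set where
  N E : Step

countN : List Step → ℕ
countN []       = 0
countN (N ∷ w)  = suc (countN w)
countN (E ∷ w)  = countN w

countE : List Step → ℕ
countE []       = 0
countE (N ∷ w)  = countE w
countE (E ∷ w)  = suc (countE w)

InL : ℕ → List Step → Set
InL n w = (countN w ≡ n) × (countE w ≡ n)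

Ballot : List Step → Set
Ballot w = ∀ k → countE (take k w) ≤ countN (take k w)

InB : ℕ → List Step → Set
InB n w = (length w ≡ 2 ℕ.* n) × Ballot w

pisFrom : ℕ → List Step → List ℕ
pisFrom c []       = []
pisFrom c (N ∷ w)  = c ∷ pisFrom c w
pisFrom c (E ∷ w)  = pisFrom (suc c) w

nth0 : List ℕ → ℕ → ℕ
nth0 []       _       = 0
nth0 (x ∷ xs) zero    = x
nth0 (x ∷ xs) (suc i) = nth0 xs i

piAt : List Step → ℕ → ℕ
piAt w i = nth0 (pisFrom 0 w) (i ℕ.∸ 1)

lamLast : ℕ → List Step → ℤ
lamLast n w =
  if (sum (map (piAt w) (map suc (upTo (n ℕ.∸ 2)))) % 2) ≡ᵇ 0
  then (+ 2) ℤ.* (+ piAt w n) - (+ piAt w (n ℕ.∸ 1))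
  else (+ (2 ℕ.* n ℕ.+ 1)) - (+ 2) ℤ.* (+ piAt w n) ℤ.+ (+ piAt w (n ℕ.∸ 1))

muLast : ℕ → List Step → ℤ
muLast n w =
  if ((n % 4) ≡ᵇ 0) ∨ ((n % 4) ≡ᵇ 3)
  then lamLast n w - (+ n)
  else (+ (n ℕ.+ 1)) - lamLast n w

muAt : ℕ → List Step → ℕ → ℤ
muAt n w i = if i <ᵇ n then (+ piAt w i) - (+ i) else muLast n w

muVec : ℕ → List Step → List ℤ
muVec n w = map (muAt n w) (map suc (upTo n))

sweep : ℤ → ℤ → List ℤ → List Step
sweep t u []       = []
sweep t u (x ∷ xs) =
  (if ⌊ x ℤ.≟ t ⌋ then N ∷ [] else if ⌊ x ℤ.≟ u ⌋ then E ∷ [] else []) ++ sweep t u xs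

SplusR : ℕ → List ℤ → List Step
SplusR j a = sweep (+ j) (+ suc j) a

SminusL : ℕ → List ℤ → List Step
SminusL j a = sweep (- (+ j)) (- (+ suc j)) (reverse a)

dropLast : List Step → List Step
dropLast []           = []
dropLast (x ∷ [])     = []
dropLast (x ∷ y ∷ ys) = x ∷ dropLast (y ∷ ys)

zetaB : ℕ → List Step → List Step
zetaB n w =
  concatMap (λ j → SminusL j μ ++ SplusR j μ) (reverse (map suc (upTo (2 ℕ.* n))))
  ++ SminusL 0 μ ++ dropLast (N ∷ SplusR 0 μ)
  where μ = muVec n w

{-# OPTIONS --safe #-}
module Submission where

-- Write w = u N Eᵗ N Eʳ. Whatever the parity of the sum and n mod 4 are, the last entry of the area vector is
-- one of the two values x = t - r and 1 - x, and replacing it by the other only moves letters across the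
-- boundary between S⁺ at height j and S⁻ at height j - 1. So it may be taken to be - m ≤ 0, where m and t + r
-- determine t and r. The area vector is then one whose entries drop by at most one from left to right, starting
-- from 0 and ending at or below 0. Its nonnegative entries, read from the right, and its nonpositive entries,
-- read from the left with an extra 0 in front, are depth sequences of plane forests with k and k + 1 trees,
-- and they determine the vector. The word N ∷ reverse (zetaB n w) lists both forests breadth first: level
-- after level, each node (N) followed by its children (E). As every level is empty or starts with N, the
-- levels can be cut off one after the other, their numbers of N's being known from the level above; the
-- starting value k is read off from the surplus 2k + 1 of N's, and the ballot condition says exactly that
-- this process never gets stuck.

open import Defs
open import Data.Bool using (true; false; if_then_else_; _∨_)
open import Data.Empty using (⊥; ⊥-elim)
open import Data.Integer as ℤ using (ℤ; +_; -[1+_]; -_; _⊖_; +≤+; -≤+; -≤-)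
import Data.Integer.Properties as ℤ
import Data.Integer.Tactic.RingSolver as ℤ-Solver
open import Data.List using (List; []; _∷_; [_]; _∷ʳ_; _++_; _ʳ++_; map; reverse; replicate; take; drop; length;
  upTo; applyUpTo; concatMap; initLast; _∷ʳ′_)
open import Data.List.Properties
open import Data.Nat using (ℕ; zero; suc; pred; _+_; _*_; _∸_; _%_; _≤_; _<_; z≤n; s≤s; s≤s⁻¹; _≡ᵇ_; _<ᵇ_)
open import Data.Nat.ListAction using (sum)
open import Data.Nat.Properties
open import Data.Nat.Tactic.RingSolver using (solve-∀)
open import Data.Product using (_×_; _,_; proj₁; proj₂; ∃-syntax)
open import Data.Sum using (_⊎_; inj₁; inj₂)
open import Data.Unit using (⊤; tt)
open import Function using (_∘_)
open import Relation.Binary.PropositionalEquality hiding ([_])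
open import Relation.Nullary.Decidable using (isYes≗does)

-- Words and levels of a pair of forests

countN-++ : ∀ u v → countN (u ++ v) ≡ countN u + countN v
countN-++ []      v = refl
countN-++ (N ∷ u) v = cong suc (countN-++ u v)
countN-++ (E ∷ u) v = countN-++ u v

countE-++ : ∀ u v → countE (u ++ v) ≡ countE u + countE v
countE-++ []      v = refl
countE-++ (N ∷ u) v = countE-++ u v
countE-++ (E ∷ u) v = cong suc (countE-++ u v)

length≡countN+countE : ∀ u → length u ≡ countN u + countE u
length≡countN+countE []      = refl
length≡countN+countE (N ∷ u) = cong suc (length≡countN+countE u)
length≡countN+countE (E ∷ u) =
  trans (cong suc (length≡countN+countE u)) (sym (+-suc (countN u) (countE u)))

countN-shift : ∀ x u r → countN u + countN (x ∷ r) ≡ countN (x ∷ u) + countN r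
countN-shift N u r = +-suc _ _
countN-shift E u r = refl

countE-shift : ∀ x u r → countE u + countE (x ∷ r) ≡ countE (x ∷ u) + countE r
countE-shift N u r = refl
countE-shift E u r = +-suc _ _

countN-∷ʳ : ∀ u x → countN (u ∷ʳ x) ≡ countN (x ∷ u)
countN-∷ʳ u x = trans (countN-++ u [ x ]) (trans (+-comm (countN u) _) (sym (countN-++ [ x ] u)))

countE-∷ʳ : ∀ u x → countE (u ∷ʳ x) ≡ countE (x ∷ u)
countE-∷ʳ u x = trans (countE-++ u [ x ]) (trans (+-comm (countE u) _) (sym (countE-++ [ x ] u)))

countN-reverse : ∀ u → countN (reverse u) ≡ countN u
countN-reverse []      = refl
countN-reverse (x ∷ u) = begin
  countN (reverse (x ∷ u))        ≡⟨ cong countN (unfold-reverse x u) ⟩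
  countN (reverse u ∷ʳ x)         ≡⟨ countN-∷ʳ (reverse u) x ⟩
  countN (x ∷ reverse u)          ≡⟨ countN-++ [ x ] (reverse u) ⟩
  countN [ x ] + countN (reverse u) ≡⟨ cong (_+_ (countN [ x ])) (countN-reverse u) ⟩
  countN [ x ] + countN u         ≡⟨ countN-++ [ x ] u ⟨
  countN (x ∷ u)                  ∎
  where open ≡-Reasoning

countE-reverse : ∀ u → countE (reverse u) ≡ countE u
countE-reverse []      = refl
countE-reverse (x ∷ u) = begin
  countE (reverse (x ∷ u))        ≡⟨ cong countE (unfold-reverse x u) ⟩
  countE (reverse u ∷ʳ x)         ≡⟨ countE-∷ʳ (reverse u) x ⟩
  countE (x ∷ reverse u)          ≡⟨ countE-++ [ x ] (reverse u) ⟩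
  countE [ x ] + countE (reverse u) ≡⟨ cong (_+_ (countE [ x ])) (countE-reverse u) ⟩
  countE [ x ] + countE u         ≡⟨ countE-++ [ x ] u ⟨
  countE (x ∷ u)                  ∎
  where open ≡-Reasoning

-- The zeta word is studied in reverse, where prefixes turn into suffixes; these are what structural
-- recursion on a list visits.
SuffixBallot : List Step → Set
SuffixBallot []      = ⊤
SuffixBallot (x ∷ u) = countE (x ∷ u) ≤ countN (x ∷ u) × SuffixBallot u

suffixBallot-total : ∀ u → SuffixBallot u → countE u ≤ countN u
suffixBallot-total []      _       = z≤n
suffixBallot-total (x ∷ u) (p , _) = p

-- The hypothesis charges all E's of `s` to `r` and ignores the N's of `s`, so it covers every cut
-- inside `s`, whatever the order of its letters.
suffixBallot-++ : ∀ s {r} → countE s + countE r ≤ countN r → SuffixBallot r → SuffixBallot (s ++ r)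
suffixBallot-++ []          p b = b
suffixBallot-++ (N ∷ s) {r} p b =
  ≤-trans (≤-reflexive (countE-++ s r))
    (≤-trans p (≤-trans (m≤n+m (countN r) (suc (countN s))) (≤-reflexive (sym (cong suc (countN-++ s r))))))
  , suffixBallot-++ s p b
suffixBallot-++ (E ∷ s) {r} p b =
  ≤-trans (≤-reflexive (cong suc (countE-++ s r)))
    (≤-trans p (≤-trans (m≤n+m (countN r) (countN s)) (≤-reflexive (sym (countN-++ s r)))))
  , suffixBallot-++ s (≤-trans (n≤1+n _) p) b

suffixBallot-drop : ∀ s {r} → SuffixBallot (s ++ r) → SuffixBallot r
suffixBallot-drop []      b       = b
suffixBallot-drop (x ∷ s) (_ , b) = suffixBallot-drop s b

-- The accumulator r is the reverse of the part of u already read.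
suffixBallot-ʳ++ : ∀ u {r} → (∀ k → countE (take k u) + countE r ≤ countN (take k u) + countN r) →
  SuffixBallot r → SuffixBallot (u ʳ++ r)
suffixBallot-ʳ++ []      h b = b
suffixBallot-ʳ++ (x ∷ u) {r} h b = suffixBallot-ʳ++ u step (first , b)
  where
  step : ∀ k → countE (take k u) + countE (x ∷ r) ≤ countN (take k u) + countN (x ∷ r)
  step k = subst₂ _≤_ (sym (countE-shift x (take k u) r)) (sym (countN-shift x (take k u) r)) (h (suc k))
  first : countE (x ∷ r) ≤ countN (x ∷ r)
  first = step 0

ballot⇒suffixBallot-reverse : ∀ u → Ballot u → SuffixBallot (reverse u)
ballot⇒suffixBallot-reverse u b =
  suffixBallot-ʳ++ u (λ k → subst₂ _≤_ (sym (+-identityʳ _)) (sym (+-identityʳ _)) (b k)) tt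

suffixBallot-reverse⇒ballot : ∀ u → SuffixBallot (reverse u) → Ballot u
suffixBallot-reverse⇒ballot u b k =
  subst₂ _≤_ (countE-reverse (take k u)) (countN-reverse (take k u))
    (suffixBallot-total _ (suffixBallot-drop (reverse (drop k u)) (subst SuffixBallot split b)))
  where
  split : reverse u ≡ reverse (drop k u) ++ reverse (take k u)
  split = trans (cong reverse (sym (take++drop≡id k u))) (reverse-++ (take k u) (drop k u))

-- Cutting a word where no E follows

NotE : List Step → Set
NotE (E ∷ _) = ⊥
NotE _       = ⊤

notE-++ : ∀ s {r} → NotE s → NotE r → NotE (s ++ r)
notE-++ []      _ q = q
notE-++ (N ∷ _) _ _ = tt

notE-prefix : ∀ s {r} → NotE (s ++ r) → NotE s
notE-prefix []      _ = tt
notE-prefix (N ∷ _) _ = tt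

-- Once its N's are spent, the prefix must absorb all E's that follow, because the remainder may not
-- begin with E. Hence the number of N's fixes the cut.
prefix-unique : ∀ s s′ {r r′} → NotE r → NotE r′ → countN s ≡ countN s′ →
  s ++ r ≡ s′ ++ r′ → s ≡ s′ × r ≡ r′
prefix-unique []      []       _ _ _ eq = refl , eq
prefix-unique []      (E ∷ _)  {r = E ∷ _} () _ _ _
prefix-unique (E ∷ _) []       {r′ = E ∷ _} _ () _ _
prefix-unique (N ∷ s) (N ∷ s′) p q c eq
  with refl , refl ← prefix-unique s s′ p q (suc-injective c) (∷-injectiveʳ eq) = refl , refl
prefix-unique (E ∷ s) (E ∷ s′) p q c eq
  with refl , refl ← prefix-unique s s′ p q c (∷-injectiveʳ eq) = refl , refl

prefix-exists : ∀ k u → k ≤ countN u → ∃[ s ] ∃[ r ] u ≡ s ++ r × countN s ≡ k × NotE r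
prefix-exists zero    []      _ = [] , [] , refl , refl , tt
prefix-exists zero    (N ∷ u) _ = [] , N ∷ u , refl , refl , tt
prefix-exists (suc k) (N ∷ u) p with prefix-exists k u (s≤s⁻¹ p)
... | s , r , refl , c , q = N ∷ s , r , refl , cong suc c , q
prefix-exists zero    (E ∷ u) p with prefix-exists zero u p
... | s , r , refl , c , q = E ∷ s , r , refl , c , q
prefix-exists (suc k) (E ∷ u) p with prefix-exists (suc k) u p
... | s , r , refl , c , q = E ∷ s , r , refl , c , q

-- Growing h s: s lists in preorder the depths of a plane forest, started below an open branch of length h.
Growing : ℕ → List ℕ → Set
Growing h []      = ⊤
Growing h (x ∷ s) = x ≤ h × Growing (suc x) s

growing-mono : ∀ {h k} s → h ≤ k → Growing h s → Growing k s
growing-mono []      _ _       = tt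
growing-mono (x ∷ s) p (q , g) = ≤-trans q p , g

zeros : List ℕ → ℕ
zeros []          = 0
zeros (zero ∷ s)  = suc (zeros s)
zeros (suc _ ∷ s) = zeros s

peel : List ℕ → List ℕ
peel []          = []
peel (zero ∷ s)  = peel s
peel (suc x ∷ s) = x ∷ peel s

letter : ℕ → ℕ → List Step
letter j x = if x ≡ᵇ j then N ∷ [] else if x ≡ᵇ suc j then E ∷ [] else []

level : ℕ → List ℕ → List Step
level j = concatMap (letter j)

growing-peel : ∀ {h} s → Growing h s → Growing (pred h) (peel s)
growing-peel []          _       = tt
growing-peel (zero ∷ s)  (_ , g) = growing-mono (peel s) z≤n (growing-peel s g)
growing-peel (suc x ∷ s) (p , g) = pred-mono-≤ p , growing-peel s g

length-peel : ∀ s → zeros s + length (peel s) ≡ length s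
length-peel []          = refl
length-peel (zero ∷ s)  = cong suc (length-peel s)
length-peel (suc _ ∷ s) = trans (+-suc _ _) (cong suc (length-peel s))

countN-level₀ : ∀ s → countN (level 0 s) ≡ zeros s
countN-level₀ []                = refl
countN-level₀ (zero ∷ s)        = cong suc (countN-level₀ s)
countN-level₀ (suc zero ∷ s)    = countN-level₀ s
countN-level₀ (suc (suc _) ∷ s) = countN-level₀ s

-- The E's of the first level are the children of the roots, that is, the roots of the peeled
-- forest. This is how the size of a level is read off the level above.
countE-level₀ : ∀ s → countE (level 0 s) ≡ zeros (peel s)
countE-level₀ []                = refl
countE-level₀ (zero ∷ s)        = countE-level₀ s
countE-level₀ (suc zero ∷ s)    = cong suc (countE-level₀ s)
countE-level₀ (suc (suc _) ∷ s) = countE-level₀ s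

level-suc : ∀ j s → level (suc j) s ≡ level j (peel s)
level-suc j []          = refl
level-suc j (zero ∷ s)  = level-suc j s
level-suc j (suc x ∷ s) = cong (letter j x ++_) (level-suc j s)

notE-level₀ : ∀ s → Growing 0 s → NotE (level 0 s)
notE-level₀ []      _       = tt
notE-level₀ (_ ∷ s) (z≤n , _) = tt

-- Inverse to s ↦ (level 0 s , peel s).
weave : List Step → List ℕ → List ℕ
weave u       (suc x ∷ s)  = suc (suc x) ∷ weave u s
weave (N ∷ u) s            = 0 ∷ weave u s
weave (E ∷ u) (zero ∷ s)   = 1 ∷ weave u s
weave (E ∷ u) []           = []
weave []      _            = []

weave-N : ∀ u s → Growing 0 s → weave (N ∷ u) s ≡ 0 ∷ weave u s
weave-N u []         _         = refl
weave-N u (zero ∷ s) _         = refl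

-- A node of depth at least 2 directly follows a node of depth at least 1, never a root. So `weave`
-- may copy such nodes before it reads the next letter, and after a root it finds nothing to copy.
weave-level₀-peel : ∀ {h} s → Growing h s → weave (level 0 s) (peel s) ≡ s
weave-level₀-peel []                _       = refl
weave-level₀-peel (zero ∷ s)        (_ , g) =
  trans (weave-N (level 0 s) (peel s) (growing-peel s g)) (cong (0 ∷_) (weave-level₀-peel s g))
weave-level₀-peel (suc zero ∷ s)    (_ , g) = cong (1 ∷_) (weave-level₀-peel s g)
weave-level₀-peel (suc (suc x) ∷ s) (_ , g) = cong (suc (suc x) ∷_) (weave-level₀-peel s g)

-- The count hypothesis excludes the clauses in which `weave` discards part of its input.
level₀-weave : ∀ u s → countE u ≡ zeros s → level 0 (weave u s) ≡ u
level₀-weave u       (suc x ∷ s)  c = level₀-weave u s c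
level₀-weave (N ∷ u) []           c = cong (N ∷_) (level₀-weave u [] c)
level₀-weave (N ∷ u) (zero ∷ s)   c = cong (N ∷_) (level₀-weave u (0 ∷ s) c)
level₀-weave (E ∷ u) (zero ∷ s)   c = cong (E ∷_) (level₀-weave u s (suc-injective c))
level₀-weave []      []           c = refl

peel-weave : ∀ u s → countE u ≡ zeros s → peel (weave u s) ≡ s
peel-weave u       (suc x ∷ s)  c = cong (suc x ∷_) (peel-weave u s c)
peel-weave (N ∷ u) []           c = peel-weave u [] c
peel-weave (N ∷ u) (zero ∷ s)   c = peel-weave u (0 ∷ s) c
peel-weave (E ∷ u) (zero ∷ s)   c = cong (0 ∷_) (peel-weave u s (suc-injective c))
peel-weave []      []           c = refl

length-weave : ∀ u s → countE u ≡ zeros s → length (weave u s) ≡ countN u + length s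
length-weave u       (suc x ∷ s)  c = trans (cong suc (length-weave u s c)) (sym (+-suc (countN u) (length s)))
length-weave (N ∷ u) []           c = cong suc (length-weave u [] c)
length-weave (N ∷ u) (zero ∷ s)   c = cong suc (length-weave u (0 ∷ s) c)
length-weave (E ∷ u) (zero ∷ s)   c =
  trans (cong suc (length-weave u s (suc-injective c))) (sym (+-suc (countN u) (length s)))
length-weave []      []           c = refl

growing-weave : ∀ {h} u s → Growing h s → Growing (suc h) (weave u s)
growing-weave u       (suc x ∷ s)  (p , g) = s≤s p , growing-weave u s g
growing-weave (N ∷ u) []           _       = z≤n , growing-weave {0} u [] tt
growing-weave (N ∷ u) (zero ∷ s)   (_ , g) = z≤n , growing-weave u (0 ∷ s) (z≤n , g)
growing-weave (E ∷ u) (zero ∷ s)   (_ , g) = s≤s z≤n , growing-weave u s g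
growing-weave (E ∷ u) []           _       = tt
growing-weave []      []           _       = tt
growing-weave []      (zero ∷ _)   _       = tt

-- A word that does not begin with E puts a root before the first child, which replaces the open
-- branch assumed in `growing-weave`.
growing₀-weave : ∀ u s → NotE u → Growing 0 s → Growing 0 (weave u s)
growing₀-weave []      []         _ _       = tt
growing₀-weave []      (zero ∷ s) _ _       = tt
growing₀-weave (N ∷ u) []         _ _       = z≤n , growing-weave {0} u [] tt
growing₀-weave (N ∷ u) (zero ∷ s) _ g       = z≤n , growing-weave u (0 ∷ s) g

-- The breadth first word of two forests

levels : ℕ → List ℕ → List ℕ → List Step
levels T P Q = concatMap (λ j → level j P ++ level j Q) (upTo T)

levels-suc : ∀ T P Q → levels (suc T) P Q ≡ level 0 P ++ level 0 Q ++ levels T (peel P) (peel Q)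
levels-suc T P Q = begin
  (level 0 P ++ level 0 Q) ++ concatMap block (applyUpTo suc T)
    ≡⟨ ++-assoc (level 0 P) (level 0 Q) _ ⟩
  level 0 P ++ level 0 Q ++ concatMap block (applyUpTo suc T)
    ≡⟨ cong (λ js → level 0 P ++ level 0 Q ++ concatMap block js) (map-upTo suc T) ⟨
  level 0 P ++ level 0 Q ++ concatMap block (map suc (upTo T))
    ≡⟨ cong (λ u → level 0 P ++ level 0 Q ++ u) (concatMap-map block suc (upTo T)) ⟩
  level 0 P ++ level 0 Q ++ concatMap (block ∘ suc) (upTo T)
    ≡⟨ cong (λ u → level 0 P ++ level 0 Q ++ u)
         (concatMap-cong (λ j → cong₂ _++_ (level-suc j P) (level-suc j Q)) (upTo T)) ⟩
  level 0 P ++ level 0 Q ++ levels T (peel P) (peel Q) ∎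
  where
  open ≡-Reasoning
  block : ℕ → List Step
  block j = level j P ++ level j Q

-- All depths in a preorder list of a forest are below its length, so the length bound ensures that
-- `T` levels exhaust the forest. It also decreases under `peel`.
record Bounded (T : ℕ) (s : List ℕ) : Set where
  constructor bounded
  field
    growing : Growing 0 s
    short   : length s ≤ T
open Bounded

-- A nonempty list that grows from 0 starts with a root, and peeling removes at least this entry.
bounded-peel : ∀ {T} s → Bounded (suc T) s → Bounded T (peel s)
bounded-peel []         _                       = bounded tt z≤n
bounded-peel (zero ∷ s) (bounded (_ , g) (s≤s l)) =
  bounded (growing-peel s g) (≤-trans (≤-trans (m≤n+m _ (zeros s)) (≤-reflexive (length-peel s))) l)

levels-notE : ∀ T {P Q} → Bounded T P → Bounded T Q → NotE (levels T P Q)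
levels-notE zero    _ _ = tt
levels-notE (suc T) {P} {Q} p q rewrite levels-suc T P Q =
  notE-++ (level 0 P) (notE-level₀ P (growing p))
    (notE-++ (level 0 Q) (notE-level₀ Q (growing q)) (levels-notE T (bounded-peel P p) (bounded-peel Q q)))

countN-levels-suc : ∀ T P Q →
  countN (levels (suc T) P Q) ≡ zeros P + (zeros Q + countN (levels T (peel P) (peel Q)))
countN-levels-suc T P Q
  rewrite levels-suc T P Q | countN-++ (level 0 P) (level 0 Q ++ levels T (peel P) (peel Q))
        | countN-++ (level 0 Q) (levels T (peel P) (peel Q)) | countN-level₀ P | countN-level₀ Q = refl

countE-levels-suc : ∀ T P Q →
  countE (levels (suc T) P Q) ≡ zeros (peel P) + (zeros (peel Q) + countE (levels T (peel P) (peel Q)))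
countE-levels-suc T P Q
  rewrite levels-suc T P Q | countE-++ (level 0 P) (level 0 Q ++ levels T (peel P) (peel Q))
        | countE-++ (level 0 Q) (levels T (peel P) (peel Q)) | countE-level₀ P | countE-level₀ Q = refl

rearrange : ∀ a b c d → a + (b + (c + d)) ≡ (a + c) + (b + d)
rearrange = solve-∀

countN-levels : ∀ T {P Q} → Bounded T P → Bounded T Q → countN (levels T P Q) ≡ length P + length Q
countN-levels zero    {[]} {[]} _ _ = refl
countN-levels zero    {_ ∷ _} (bounded _ ()) _
countN-levels zero    {[]} {_ ∷ _} _ (bounded _ ())
countN-levels (suc T) {P} {Q} p q = begin
  countN (levels (suc T) P Q)
    ≡⟨ countN-levels-suc T P Q ⟩
  zeros P + (zeros Q + countN (levels T (peel P) (peel Q)))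
    ≡⟨ cong (λ c → zeros P + (zeros Q + c)) (countN-levels T (bounded-peel P p) (bounded-peel Q q)) ⟩
  zeros P + (zeros Q + (length (peel P) + length (peel Q)))
    ≡⟨ rearrange (zeros P) (zeros Q) (length (peel P)) (length (peel Q)) ⟩
  (zeros P + length (peel P)) + (zeros Q + length (peel Q))
    ≡⟨ cong₂ _+_ (length-peel P) (length-peel Q) ⟩
  length P + length Q ∎
  where open ≡-Reasoning

-- Every node is written once as N, and every node other than a root once as E, in the level of its
-- parent. In the induction the E's of one level match the N's of the next.
surplus-levels : ∀ T {P Q} → Bounded T P → Bounded T Q →
  zeros P + (zeros Q + countE (levels T P Q)) ≡ countN (levels T P Q)
surplus-levels zero    {[]} {[]} _ _ = refl
surplus-levels zero    {_ ∷ _} (bounded _ ()) _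
surplus-levels zero    {[]} {_ ∷ _} _ (bounded _ ())
surplus-levels (suc T) {P} {Q} p q = begin
  zeros P + (zeros Q + countE (levels (suc T) P Q))
    ≡⟨ cong (λ c → zeros P + (zeros Q + c)) (countE-levels-suc T P Q) ⟩
  zeros P + (zeros Q + (zeros (peel P) + (zeros (peel Q) + countE (levels T (peel P) (peel Q)))))
    ≡⟨ cong (λ c → zeros P + (zeros Q + c)) (surplus-levels T (bounded-peel P p) (bounded-peel Q q)) ⟩
  zeros P + (zeros Q + countN (levels T (peel P) (peel Q)))
    ≡⟨ countN-levels-suc T P Q ⟨
  countN (levels (suc T) P Q) ∎
  where open ≡-Reasoning

-- The E's of the first level are the roots of the peeled forests, so by `surplus-levels` they use
-- up the surplus of the rest exactly. Then `suffixBallot-++` covers the suffixes that start inside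
-- this level.
levels-suffixBallot : ∀ T {P Q} → Bounded T P → Bounded T Q → SuffixBallot (levels T P Q)
levels-suffixBallot zero    _ _ = tt
levels-suffixBallot (suc T) {P} {Q} p q rewrite levels-suc T P Q
  | sym (++-assoc (level 0 P) (level 0 Q) (levels T (peel P) (peel Q))) =
  suffixBallot-++ (level 0 P ++ level 0 Q) (≤-reflexive tight)
    (levels-suffixBallot T (bounded-peel P p) (bounded-peel Q q))
  where
  tight : countE (level 0 P ++ level 0 Q) + countE (levels T (peel P) (peel Q))
        ≡ countN (levels T (peel P) (peel Q))
  tight rewrite countE-++ (level 0 P) (level 0 Q) | countE-level₀ P | countE-level₀ Q
    | +-assoc (zeros (peel P)) (zeros (peel Q)) (countE (levels T (peel P) (peel Q))) =
    surplus-levels T (bounded-peel P p) (bounded-peel Q q)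

-- The numbers of trees locate the first two cuts. The E's of the two pieces give the numbers of
-- trees of the peeled forests, to which the induction applies, and `weave` reassembles both
-- forests.
levels-injective : ∀ T {P Q P′ Q′} → Bounded T P → Bounded T Q → Bounded T P′ → Bounded T Q′ →
  zeros P ≡ zeros P′ → zeros Q ≡ zeros Q′ → levels T P Q ≡ levels T P′ Q′ → P ≡ P′ × Q ≡ Q′
levels-injective zero {[]} {[]} {[]} {[]} _ _ _ _ _ _ _ = refl , refl
levels-injective zero {_ ∷ _} (bounded _ ()) _ _ _ _ _ _
levels-injective zero {[]} {_ ∷ _} _ (bounded _ ()) _ _ _ _ _
levels-injective zero {[]} {[]} {_ ∷ _} _ _ (bounded _ ()) _ _ _ _
levels-injective zero {[]} {[]} {[]} {_ ∷ _} _ _ _ (bounded _ ()) _ _ _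
levels-injective (suc T) {P} {Q} {P′} {Q′} p q p′ q′ zP zQ eq
  with eqP , rest ← prefix-unique (level 0 P) (level 0 P′)
         (notE-++ (level 0 Q) (notE-level₀ Q (growing q)) (levels-notE T (bounded-peel P p) (bounded-peel Q q)))
         (notE-++ (level 0 Q′) (notE-level₀ Q′ (growing q′))
           (levels-notE T (bounded-peel P′ p′) (bounded-peel Q′ q′)))
         (trans (countN-level₀ P) (trans zP (sym (countN-level₀ P′))))
         (trans (sym (levels-suc T P Q)) (trans eq (levels-suc T P′ Q′)))
  with eqQ , rest′ ← prefix-unique (level 0 Q) (level 0 Q′)
         (levels-notE T (bounded-peel P p) (bounded-peel Q q))
         (levels-notE T (bounded-peel P′ p′) (bounded-peel Q′ q′))
         (trans (countN-level₀ Q) (trans zQ (sym (countN-level₀ Q′)))) rest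
  with peelP , peelQ ← levels-injective T
         (bounded-peel P p) (bounded-peel Q q) (bounded-peel P′ p′) (bounded-peel Q′ q′)
         (trans (sym (countE-level₀ P)) (trans (cong countE eqP) (countE-level₀ P′)))
         (trans (sym (countE-level₀ Q)) (trans (cong countE eqQ) (countE-level₀ Q′))) rest′
  = rebuild p p′ eqP peelP , rebuild q q′ eqQ peelQ
  where
  rebuild : ∀ {s s′} → Bounded (suc T) s → Bounded (suc T) s′ →
    level 0 s ≡ level 0 s′ → peel s ≡ peel s′ → s ≡ s′
  rebuild {s} {s′} b b′ eq₀ eq₁ =
    trans (sym (weave-level₀-peel s (growing b)))
      (trans (cong₂ weave eq₀ eq₁) (weave-level₀-peel s′ (growing b′)))

-- If no letter is cut off although u is not empty, then u = N ∷ v has surplus 0, so v violates the ballot condition.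
length-rest : ∀ s t {r T} → NotE (s ++ t ++ r) → SuffixBallot (s ++ t ++ r) →
  countN (s ++ t ++ r) ≡ countE (s ++ t ++ r) + (countN s + countN t) →
  length (s ++ t ++ r) ≤ suc T → length r ≤ T
length-rest [] [] {[]} _ _ _ _ = z≤n
length-rest [] [] {N ∷ r} _ (_ , b) c _ =
  ⊥-elim (1+n≰n (≤-trans (≤-reflexive (trans c (+-identityʳ _))) (suffixBallot-total r b)))
length-rest [] (x ∷ t) {r} _ _ _ (s≤s l) =
  ≤-trans (≤-trans (m≤n+m _ (length t)) (≤-reflexive (sym (length-++ t)))) l
length-rest (x ∷ s) t {r} _ _ _ (s≤s l) =
  ≤-trans (≤-trans (m≤n+m _ (length t)) (≤-reflexive (sym (length-++ t))))
    (≤-trans (≤-trans (m≤n+m _ (length s)) (≤-reflexive (sym (length-++ s)))) l)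

-- The count condition is the surplus identity for forests with `a` and `b` trees. It passes to the
-- remainder, with the E's of the two pieces cut off as the new numbers of trees, and `length-rest`
-- supports the induction on `T`.
levels-surjective : ∀ T u a b → length u ≤ T → NotE u → SuffixBallot u → countN u ≡ countE u + (a + b) →
  ∃[ P ] ∃[ Q ] Growing 0 P × Growing 0 Q × zeros P ≡ a × zeros Q ≡ b ×
    length P + length Q ≡ countN u × levels T P Q ≡ u
levels-surjective zero [] zero zero _ _ _ _ = [] , [] , tt , tt , refl , refl , refl , refl
levels-surjective (suc T) u a b l ne bal c
  with prefix-exists a u (≤-trans (m≤m+n a b) (≤-trans (m≤n+m _ (countE u)) (≤-reflexive (sym c))))
... | s , v , refl , cs , nv
  with prefix-exists b v (+-cancelˡ-≤ a b (countN v)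
         (≤-trans (m≤n+m _ (countE (s ++ v)))
           (≤-reflexive (trans (sym c) (trans (countN-++ s v) (cong (_+ countN v) cs))))))
... | t , r , refl , ct , nr
  with levels-surjective T r (countE s) (countE t)
         (length-rest s t ne bal (trans c (cong (_+_ (countE (s ++ t ++ r))) (cong₂ _+_ (sym cs) (sym ct)))) l)
         nr (suffixBallot-drop t (suffixBallot-drop s bal)) count
  where
  count : countN r ≡ countE r + (countE s + countE t)
  count = +-cancelˡ-≡ (a + b) _ _ (begin
    (a + b) + countN r                                   ≡⟨ cong (_+ countN r) (cong₂ _+_ cs ct) ⟨
    (countN s + countN t) + countN r                     ≡⟨ +-assoc (countN s) (countN t) (countN r) ⟩
    countN s + (countN t + countN r)                     ≡⟨ cong (_+_ (countN s)) (countN-++ t r) ⟨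
    countN s + countN (t ++ r)                           ≡⟨ countN-++ s (t ++ r) ⟨
    countN (s ++ t ++ r)                                 ≡⟨ c ⟩
    countE (s ++ t ++ r) + (a + b)
      ≡⟨ cong (_+ (a + b)) (trans (countE-++ s (t ++ r)) (cong (_+_ (countE s)) (countE-++ t r))) ⟩
    (countE s + (countE t + countE r)) + (a + b)
      ≡⟨ lemma (countE s) (countE t) (countE r) (a + b) ⟩
    (a + b) + (countE r + (countE s + countE t)) ∎)
    where
    open ≡-Reasoning
    lemma : ∀ x y z w → (x + (y + z)) + w ≡ w + (z + (x + y))
    lemma = solve-∀
... | P , Q , gP , gQ , zP , zQ , size , eq =
  weave s P , weave t Q
  , growing₀-weave s P (notE-prefix s ne) gP , growing₀-weave t Q (notE-prefix t nv) gQ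
  , trans (sym (countN-level₀ (weave s P))) (trans (cong countN levelP) cs)
  , trans (sym (countN-level₀ (weave t Q))) (trans (cong countN levelQ) ct)
  , (begin
      length (weave s P) + length (weave t Q)
        ≡⟨ cong₂ _+_ (length-weave s P (sym zP)) (length-weave t Q (sym zQ)) ⟩
      (countN s + length P) + (countN t + length Q)
        ≡⟨ rearrange (countN s) (countN t) (length P) (length Q) ⟨
      countN s + (countN t + (length P + length Q))
        ≡⟨ cong (λ c → countN s + (countN t + c)) size ⟩
      countN s + (countN t + countN r)
        ≡⟨ trans (countN-++ s (t ++ r)) (cong (_+_ (countN s)) (countN-++ t r)) ⟨
      countN (s ++ t ++ r) ∎)
  , (begin
      levels (suc T) (weave s P) (weave t Q)
        ≡⟨ levels-suc T (weave s P) (weave t Q) ⟩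
      level 0 (weave s P) ++ level 0 (weave t Q) ++ levels T (peel (weave s P)) (peel (weave t Q))
        ≡⟨ cong₂ _++_ levelP (cong₂ _++_ levelQ
             (cong₂ (levels T) (peel-weave s P (sym zP)) (peel-weave t Q (sym zQ)))) ⟩
      s ++ t ++ levels T P Q
        ≡⟨ cong (λ v → s ++ t ++ v) eq ⟩
      s ++ t ++ r ∎)
  where
  open ≡-Reasoning
  levelP : level 0 (weave s P) ≡ s
  levelP = level₀-weave s P (sym zP)
  levelQ : level 0 (weave t Q) ≡ t
  levelQ = level₀-weave t Q (sym zQ)

-- Area vectors as pairs of forests

nonneg : List ℤ → List ℕ
nonneg []              = []
nonneg (+ m ∷ a)       = m ∷ nonneg a
nonneg (-[1+ _ ] ∷ a)  = nonneg a

nonpos : List ℤ → List ℕ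
nonpos []              = []
nonpos (+ zero ∷ a)    = 0 ∷ nonpos a
nonpos (+ suc _ ∷ a)   = nonpos a
nonpos (-[1+ m ] ∷ a)  = suc m ∷ nonpos a

Area : ℤ → List ℤ → Set
Area h []      = h ℤ.≤ + 0
Area h (x ∷ a) = h ℤ.≤ ℤ.suc x × Area x a

-- With `Shrinking`, this is the growth condition seen from the other end: an entry is bounded by
-- its right neighbour, and the last entry is 0.
room : List ℕ → ℕ
room []      = 0
room (x ∷ _) = suc x

Shrinking : List ℕ → Set
Shrinking []      = ⊤
Shrinking (x ∷ p) = x ≤ room p × Shrinking p

growing-ʳ++ : ∀ p {s} → Shrinking p → Growing (room p) s → Growing 0 (p ʳ++ s)
growing-ʳ++ []      _       g = g
growing-ʳ++ (x ∷ p) (q , d) g = growing-ʳ++ p d (q , g)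

shrinking-ʳ++ : ∀ s {p} → Growing (room p) s → Shrinking p → Shrinking (s ʳ++ p)
shrinking-ʳ++ []      _       d = d
shrinking-ʳ++ (x ∷ s) (q , g) d = shrinking-ʳ++ s g (q , d)

zeros-ʳ++ : ∀ p s → zeros (p ʳ++ s) ≡ zeros p + zeros s
zeros-ʳ++ []          s = refl
zeros-ʳ++ (zero ∷ p)  s = trans (zeros-ʳ++ p (0 ∷ s)) (+-suc (zeros p) (zeros s))
zeros-ʳ++ (suc x ∷ p) s = zeros-ʳ++ p (suc x ∷ s)

zeros-reverse : ∀ p → zeros (reverse p) ≡ zeros p
zeros-reverse p = trans (zeros-ʳ++ p []) (+-identityʳ _)

posPart : ℤ → ℕ
posPart (+ k)    = k
posPart -[1+ _ ] = 0

-- The bound for the next nonpositive entry after h; a positive h has to come back to 0 first.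
bound : ℤ → ℕ
bound (+ zero)  = 1
bound (+ suc _) = 0
bound -[1+ k ]  = suc (suc k)

-- A nonnegative entry directly before a negative one must be 0. So negative stretches can be
-- deleted without violating the bound on drops, and the final condition forces the last nonnegative
-- entry to be 0.
shrinking-nonneg : ∀ {h} a → Area h a → Shrinking (nonneg a) × posPart h ≤ room (nonneg a)
shrinking-nonneg {+ _}      []  (+≤+ z≤n) = tt , z≤n
shrinking-nonneg { -[1+ _ ]} [] _         = tt , z≤n
shrinking-nonneg {h} (+ m ∷ a) (p , v) with shrinking-nonneg a v
... | d , q = (q , d) , step h p
  where
  step : ∀ h → h ℤ.≤ ℤ.suc (+ m) → posPart h ≤ suc m
  step (+ k)    (+≤+ p) = p
  step -[1+ _ ] _       = z≤n
shrinking-nonneg {h} (-[1+ m ] ∷ a) (p , v) with shrinking-nonneg a v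
... | d , _ = d , ≤-trans (step h m p) z≤n
  where
  step : ∀ h m → h ℤ.≤ ℤ.suc -[1+ m ] → posPart h ≤ 0
  step (+ k)    zero    (+≤+ p) = p
  step -[1+ _ ] _       _       = z≤n

-- A drop by at most one is a rise by at most one of the absolute value. A positive stretch returns
-- to the nonpositive entries only through 0, so the next entry listed after it is 0.
growing-nonpos : ∀ {h} a → Area h a → Growing (bound h) (nonpos a)
growing-nonpos []               _       = tt
growing-nonpos (+ zero ∷ a)     (_ , v) = z≤n , growing-nonpos a v
growing-nonpos (+ suc m ∷ a)    (_ , v) = growing-mono (nonpos a) z≤n (growing-nonpos a v)
growing-nonpos {h} (-[1+ m ] ∷ a) (p , v) = step h m p , growing-nonpos a v
  where
  step : ∀ h m → h ℤ.≤ ℤ.suc -[1+ m ] → suc m ≤ bound h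
  step (+ zero)  zero    _        = s≤s z≤n
  step (+ suc _) zero    (+≤+ ())
  step -[1+ _ ]  zero    _        = s≤s z≤n
  step -[1+ _ ]  (suc m) (-≤- p)  = s≤s (s≤s p)

zeros-nonneg : ∀ a → zeros (nonneg a) ≡ zeros (nonpos a)
zeros-nonneg []             = refl
zeros-nonneg (+ zero ∷ a)   = cong suc (zeros-nonneg a)
zeros-nonneg (+ suc _ ∷ a)  = zeros-nonneg a
zeros-nonneg (-[1+ _ ] ∷ a) = zeros-nonneg a

length-nonneg-nonpos : ∀ a → length (nonneg a) + length (nonpos a) ≡ length a + zeros (nonneg a)
length-nonneg-nonpos []             = refl
length-nonneg-nonpos (+ zero ∷ a)   = cong suc (trans (+-suc _ _)
  (trans (cong suc (length-nonneg-nonpos a)) (sym (+-suc (length a) _))))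
length-nonneg-nonpos (+ suc _ ∷ a)  = cong suc (length-nonneg-nonpos a)
length-nonneg-nonpos (-[1+ _ ] ∷ a) = trans (+-suc _ _) (cong suc (length-nonneg-nonpos a))

length-nonneg : ∀ a → length (nonneg a) ≤ length a
length-nonneg []             = z≤n
length-nonneg (+ _ ∷ a)      = s≤s (length-nonneg a)
length-nonneg (-[1+ _ ] ∷ a) = m≤n⇒m≤1+n (length-nonneg a)

length-nonpos : ∀ a → length (nonpos a) ≤ length a
length-nonpos []             = z≤n
length-nonpos (+ zero ∷ a)   = s≤s (length-nonpos a)
length-nonpos (+ suc _ ∷ a)  = m≤n⇒m≤1+n (length-nonpos a)
length-nonpos (-[1+ _ ] ∷ a) = s≤s (length-nonpos a)

-- Inverse to a ↦ (nonneg a , nonpos a).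
merge : List ℕ → List ℕ → List ℤ
merge p           (suc m ∷ q) = -[1+ m ] ∷ merge p q
merge (suc m ∷ p) []          = + suc m ∷ merge p []
merge (suc m ∷ p) (zero ∷ q)  = + suc m ∷ merge p (zero ∷ q)
merge (zero ∷ p)  (zero ∷ q)  = + 0 ∷ merge p q
merge (zero ∷ p)  []          = []
merge []          _           = []

merge-suc : ∀ m p q → Growing 0 q → merge (suc m ∷ p) q ≡ + suc m ∷ merge p q
merge-suc m p []         _ = refl
merge-suc m p (zero ∷ q) _ = refl

-- A negative entry cannot directly follow a positive one, so between two zeros all negative entries
-- precede the positive ones. This is the order in which `merge` emits them; the zeros, present in
-- both lists, synchronise it.
merge-nonneg-nonpos : ∀ {h} a → Area h a → merge (nonneg a) (nonpos a) ≡ a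
merge-nonneg-nonpos []             _       = refl
merge-nonneg-nonpos (+ zero ∷ a)   (_ , v) = cong (+ 0 ∷_) (merge-nonneg-nonpos a v)
merge-nonneg-nonpos (+ suc m ∷ a)  (_ , v) =
  trans (merge-suc m (nonneg a) (nonpos a) (growing-nonpos a v)) (cong (+ suc m ∷_) (merge-nonneg-nonpos a v))
merge-nonneg-nonpos (-[1+ m ] ∷ a) (_ , v) = cong (-[1+ m ] ∷_) (merge-nonneg-nonpos a v)

nonneg-merge : ∀ p q → zeros p ≡ zeros q → nonneg (merge p q) ≡ p
nonneg-merge p           (suc m ∷ q) z = nonneg-merge p q z
nonneg-merge (suc m ∷ p) []          z = cong (suc m ∷_) (nonneg-merge p [] z)
nonneg-merge (suc m ∷ p) (zero ∷ q)  z = cong (suc m ∷_) (nonneg-merge p (0 ∷ q) z)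
nonneg-merge (zero ∷ p)  (zero ∷ q)  z = cong (0 ∷_) (nonneg-merge p q (suc-injective z))
nonneg-merge []          []          z = refl

nonpos-merge : ∀ p q → zeros p ≡ zeros q → nonpos (merge p q) ≡ q
nonpos-merge p           (suc m ∷ q) z = cong (suc m ∷_) (nonpos-merge p q z)
nonpos-merge (suc m ∷ p) []          z = nonpos-merge p [] z
nonpos-merge (suc m ∷ p) (zero ∷ q)  z = nonpos-merge p (0 ∷ q) z
nonpos-merge (zero ∷ p)  (zero ∷ q)  z = cong (0 ∷_) (nonpos-merge p q (suc-injective z))
nonpos-merge []          []          z = refl

posPart-≤ : ∀ {h m} → posPart h ≤ m → h ℤ.≤ + m
posPart-≤ {+ _}       p = +≤+ p
posPart-≤ { -[1+ _ ]} _ = -≤+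

-- The drop from `h` to a negative entry is controlled by `bound h`; the drop to a nonnegative
-- entry, or to the end of the list, by `posPart h`.
area-merge : ∀ {h} p q → Shrinking p → posPart h ≤ room p → Growing (bound h) q → zeros p ≡ zeros q →
  Area h (merge p q)
area-merge {h} p (suc m ∷ q) d _ (b , g) z = step h m b , area-merge p q d z≤n g z
  where
  step : ∀ h m → suc m ≤ bound h → h ℤ.≤ ℤ.suc -[1+ m ]
  step (+ zero)  zero    _             = +≤+ z≤n
  step (+ zero)  (suc m) (s≤s ())
  step -[1+ _ ]  zero    _             = -≤+
  step -[1+ _ ]  (suc m) (s≤s (s≤s p)) = -≤- p
area-merge (suc m ∷ p) []         (r , d) c g z = posPart-≤ c , area-merge p [] d r tt z
area-merge (suc m ∷ p) (zero ∷ q) (r , d) c (_ , g) z =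
  posPart-≤ c , area-merge p (0 ∷ q) d r (z≤n , g) z
area-merge (zero ∷ p)  (zero ∷ q) (r , d) c (_ , g) z =
  posPart-≤ c , area-merge p q d z≤n g (suc-injective z)
area-merge []          []         _ c _ _ = posPart-≤ c

-- The sweep words of an area vector

nonneg-++ : ∀ a b → nonneg (a ++ b) ≡ nonneg a ++ nonneg b
nonneg-++ []             b = refl
nonneg-++ (+ m ∷ a)      b = cong (m ∷_) (nonneg-++ a b)
nonneg-++ (-[1+ _ ] ∷ a) b = nonneg-++ a b

nonpos-++ : ∀ a b → nonpos (a ++ b) ≡ nonpos a ++ nonpos b
nonpos-++ []             b = refl
nonpos-++ (+ zero ∷ a)   b = cong (0 ∷_) (nonpos-++ a b)
nonpos-++ (+ suc _ ∷ a)  b = nonpos-++ a b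
nonpos-++ (-[1+ m ] ∷ a) b = cong (suc m ∷_) (nonpos-++ a b)

nonpos-ʳ++ : ∀ a {b} → nonpos (a ʳ++ b) ≡ nonpos a ʳ++ nonpos b
nonpos-ʳ++ []             = refl
nonpos-ʳ++ (+ zero ∷ a)   = nonpos-ʳ++ a
nonpos-ʳ++ (+ suc _ ∷ a)  = nonpos-ʳ++ a
nonpos-ʳ++ (-[1+ m ] ∷ a) = nonpos-ʳ++ a

nonpos-negated : ∀ m → nonpos [ - + m ] ≡ [ m ]
nonpos-negated zero    = refl
nonpos-negated (suc _) = refl

sweep-nonneg : ∀ j a → SplusR j a ≡ level j (nonneg a)
sweep-nonneg j []             = refl
sweep-nonneg j (+ m ∷ a)
  rewrite isYes≗does (+ m ℤ.≟ + j) | isYes≗does (+ m ℤ.≟ + suc j) = cong (letter j m ++_) (sweep-nonneg j a)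
sweep-nonneg j (-[1+ _ ] ∷ a) = sweep-nonneg j a

sweep-nonpos : ∀ j a → sweep (- + j) (- + suc j) a ≡ level j (nonpos a)
sweep-nonpos j       []             = refl
sweep-nonpos zero    (+ zero ∷ a)   = cong (N ∷_) (sweep-nonpos 0 a)
sweep-nonpos zero    (+ suc _ ∷ a)  = sweep-nonpos 0 a
sweep-nonpos zero    (-[1+ m ] ∷ a)
  rewrite isYes≗does (-[1+ m ] ℤ.≟ -[1+ 0 ]) = cong (letter 0 (suc m) ++_) (sweep-nonpos 0 a)
sweep-nonpos (suc j) (+ zero ∷ a)   = sweep-nonpos (suc j) a
sweep-nonpos (suc j) (+ suc _ ∷ a)  = sweep-nonpos (suc j) a
sweep-nonpos (suc j) (-[1+ m ] ∷ a)
  rewrite isYes≗does (-[1+ m ] ℤ.≟ -[1+ j ]) | isYes≗does (-[1+ m ] ℤ.≟ -[1+ suc j ])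
  = cong (letter (suc j) (suc m) ++_) (sweep-nonpos (suc j) a)

SminusL-nonpos : ∀ j a → SminusL j a ≡ level j (reverse (nonpos a))
SminusL-nonpos j a = trans (sweep-nonpos j (reverse a)) (cong (level j) (nonpos-ʳ++ a))

blocks : ℕ → List ℕ → List ℕ → List Step
blocks T p q = concatMap (λ j → level j (reverse q) ++ level j p) (reverse (map suc (upTo T)))

sweeps : ℕ → List ℕ → List ℕ → List Step
sweeps T p q = blocks T p q ++ level 0 (reverse q) ++ dropLast (N ∷ level 0 p)

zetaB≡sweeps : ∀ n w → zetaB n w ≡ sweeps (2 * n) (nonneg (muVec n w)) (nonpos (muVec n w))
zetaB≡sweeps n w = cong₂ _++_
  (concatMap-cong (λ j → cong₂ _++_ (SminusL-nonpos j μ) (sweep-nonneg j μ)) (reverse (map suc (upTo (2 * n)))))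
  (cong₂ _++_ (SminusL-nonpos 0 μ) (cong (λ u → dropLast (N ∷ u)) (sweep-nonneg 0 μ)))
  where μ = muVec n w

blocks-suc : ∀ T p q → blocks (suc T) p q ≡ level (suc T) (reverse q) ++ level (suc T) p ++ blocks T p q
blocks-suc T p q = begin
  concatMap block (reverse (map suc (upTo (suc T))))
    ≡⟨ cong (λ js → concatMap block (reverse (map suc js))) (upTo-∷ʳ T) ⟨
  concatMap block (reverse (map suc (upTo T ∷ʳ T)))
    ≡⟨ cong (concatMap block ∘ reverse) (map-++ suc (upTo T) [ T ]) ⟩
  concatMap block (reverse (map suc (upTo T) ∷ʳ suc T))
    ≡⟨ cong (concatMap block) (reverse-++ (map suc (upTo T)) [ suc T ]) ⟩
  (level (suc T) (reverse q) ++ level (suc T) p) ++ blocks T p q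
    ≡⟨ ++-assoc (level (suc T) (reverse q)) _ _ ⟩
  level (suc T) (reverse q) ++ level (suc T) p ++ blocks T p q ∎
  where
  open ≡-Reasoning
  block : ℕ → List Step
  block j = level j (reverse q) ++ level j p

dropLast-∷ʳ : ∀ u x → dropLast (u ∷ʳ x) ≡ u
dropLast-∷ʳ []          x = refl
dropLast-∷ʳ (y ∷ [])    x = refl
dropLast-∷ʳ (y ∷ z ∷ u) x = cong (y ∷_) (dropLast-∷ʳ (z ∷ u) x)

level-∷ʳ : ∀ j s x → level j (s ∷ʳ x) ≡ level j s ++ letter j x
level-∷ʳ j s x = trans (concatMap-++ (letter j) s [ x ]) (cong (level j s ++_) (++-identityʳ (letter j x)))

level-suc-nonneg-negated : ∀ j p m → level (suc j) (p ++ nonneg [ - + m ]) ≡ level (suc j) p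
level-suc-nonneg-negated j p zero    = trans (level-∷ʳ (suc j) p 0) (++-identityʳ _)
level-suc-nonneg-negated j p (suc m) = cong (level (suc j)) (++-identityʳ p)

level-reverse-∷ʳ : ∀ j q m → level j (reverse (q ∷ʳ m)) ≡ letter j m ++ level j (reverse q)
level-reverse-∷ʳ j q m = cong (level j) (reverse-++ q [ m ])

-- An entry 1 + m at the end of the vector contributes the last letters of S⁺ at heights 1 + m and m, and
-- the entry - m the first letters of the blocks S⁻ at heights m and m - 1, which come directly after.
blocks-reflect : ∀ T p q m →
  blocks T (p ++ nonneg [ - + m ]) (q ∷ʳ m) ++ level 0 (reverse (q ∷ʳ m))
  ≡ letter T m ++ blocks T (p ∷ʳ suc m) q ++ level 0 (reverse q)
blocks-reflect zero    p q m = level-reverse-∷ʳ 0 q m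
blocks-reflect (suc T) p q m = begin
  blocks (suc T) p₁ q₁ ++ R₁
    ≡⟨ cong (_++ R₁) (blocks-suc T p₁ q₁) ⟩
  (level (suc T) (reverse q₁) ++ level (suc T) p₁ ++ blocks T p₁ q₁) ++ R₁
    ≡⟨ cong (_++ R₁) (cong₂ (λ u v → u ++ v ++ blocks T p₁ q₁)
         (level-reverse-∷ʳ (suc T) q m) (level-suc-nonneg-negated T p m)) ⟩
  ((ℓ ++ S) ++ level (suc T) p ++ blocks T p₁ q₁) ++ R₁
    ≡⟨ ++-assoc (ℓ ++ S) _ R₁ ⟩
  (ℓ ++ S) ++ (level (suc T) p ++ blocks T p₁ q₁) ++ R₁
    ≡⟨ cong ((ℓ ++ S) ++_) (++-assoc (level (suc T) p) _ R₁) ⟩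
  (ℓ ++ S) ++ level (suc T) p ++ blocks T p₁ q₁ ++ R₁
    ≡⟨ cong (λ u → (ℓ ++ S) ++ level (suc T) p ++ u) (blocks-reflect T p q m) ⟩
  (ℓ ++ S) ++ level (suc T) p ++ letter T m ++ blocks T p₂ q ++ R₂
    ≡⟨ cong ((ℓ ++ S) ++_) (++-assoc (level (suc T) p) (letter T m) _) ⟨
  (ℓ ++ S) ++ (level (suc T) p ++ letter T m) ++ blocks T p₂ q ++ R₂
    ≡⟨ cong (λ u → (ℓ ++ S) ++ u ++ blocks T p₂ q ++ R₂) (level-∷ʳ (suc T) p (suc m)) ⟨
  (ℓ ++ S) ++ level (suc T) p₂ ++ blocks T p₂ q ++ R₂
    ≡⟨ ++-assoc ℓ S _ ⟩
  ℓ ++ S ++ level (suc T) p₂ ++ blocks T p₂ q ++ R₂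
    ≡⟨ cong (λ u → ℓ ++ S ++ u) (++-assoc (level (suc T) p₂) _ R₂) ⟨
  ℓ ++ S ++ (level (suc T) p₂ ++ blocks T p₂ q) ++ R₂
    ≡⟨ cong (ℓ ++_) (++-assoc S _ R₂) ⟨
  ℓ ++ (S ++ level (suc T) p₂ ++ blocks T p₂ q) ++ R₂
    ≡⟨ cong (λ u → ℓ ++ u ++ R₂) (blocks-suc T p₂ q) ⟨
  ℓ ++ blocks (suc T) p₂ q ++ R₂ ∎
  where
  open ≡-Reasoning
  p₁ = p ++ nonneg [ - + m ]
  q₁ = q ∷ʳ m
  p₂ = p ∷ʳ suc m
  ℓ  = letter (suc T) m
  S  = level (suc T) (reverse q)
  R₁ = level 0 (reverse q₁)
  R₂ = level 0 (reverse q)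

-- For `m = 0` the two words differ only in their last letter, N for the entry 0 and E for the entry
-- 1, and this is the letter deleted. For larger `m` neither entry leaves a letter here.
dropLast-reflect : ∀ p m → dropLast (N ∷ level 0 (p ++ nonneg [ - + m ])) ≡ dropLast (N ∷ level 0 (p ∷ʳ suc m))
dropLast-reflect p zero    = begin
  dropLast (N ∷ level 0 (p ∷ʳ 0))  ≡⟨ cong (λ u → dropLast (N ∷ u)) (level-∷ʳ 0 p 0) ⟩
  dropLast ((N ∷ level 0 p) ∷ʳ N)  ≡⟨ dropLast-∷ʳ (N ∷ level 0 p) N ⟩
  N ∷ level 0 p                    ≡⟨ dropLast-∷ʳ (N ∷ level 0 p) E ⟨
  dropLast ((N ∷ level 0 p) ∷ʳ E)  ≡⟨ cong (λ u → dropLast (N ∷ u)) (level-∷ʳ 0 p 1) ⟨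
  dropLast (N ∷ level 0 (p ∷ʳ 1))  ∎
  where open ≡-Reasoning
dropLast-reflect p (suc m) = cong (λ u → dropLast (N ∷ u))
  (trans (cong (level 0) (++-identityʳ p)) (sym (trans (level-∷ʳ 0 p (suc (suc m))) (++-identityʳ _))))

letter-above : ∀ {T m} → m < T → letter T m ≡ []
letter-above {suc T} {zero}  _       = refl
letter-above {suc T} {suc m} (s≤s p) = letter-above p

-- The letter that `blocks-reflect` leaves over at the top height is absent because `m < T`.
sweeps-reflect : ∀ {T m} a → m < T →
  sweeps T (nonneg (a ∷ʳ + suc m)) (nonpos (a ∷ʳ + suc m)) ≡ sweeps T (nonneg (a ∷ʳ - + m)) (nonpos (a ∷ʳ - + m))
sweeps-reflect {T} {m} a m<T
  rewrite nonneg-++ a [ + suc m ] | nonpos-++ a [ + suc m ] | nonneg-++ a [ - + m ] | nonpos-++ a [ - + m ]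
        | nonpos-negated m | ++-identityʳ (nonpos a) = begin
  blocks T p₂ q ++ level 0 (reverse q) ++ dropLast (N ∷ level 0 p₂)
    ≡⟨ ++-assoc (blocks T p₂ q) _ _ ⟨
  (blocks T p₂ q ++ level 0 (reverse q)) ++ dropLast (N ∷ level 0 p₂)
    ≡⟨ cong₂ _++_ (cong (_++ (blocks T p₂ q ++ level 0 (reverse q))) (letter-above m<T)) (dropLast-reflect p m) ⟨
  (letter T m ++ blocks T p₂ q ++ level 0 (reverse q)) ++ dropLast (N ∷ level 0 p₁)
    ≡⟨ cong (_++ dropLast (N ∷ level 0 p₁)) (blocks-reflect T p q m) ⟨
  (blocks T p₁ q₁ ++ level 0 (reverse q₁)) ++ dropLast (N ∷ level 0 p₁)
    ≡⟨ ++-assoc (blocks T p₁ q₁) _ _ ⟩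
  blocks T p₁ q₁ ++ level 0 (reverse q₁) ++ dropLast (N ∷ level 0 p₁) ∎
  where
  open ≡-Reasoning
  p  = nonneg a
  q  = nonpos a
  p₁ = p ++ nonneg [ - + m ]
  q₁ = q ∷ʳ m
  p₂ = p ∷ʳ suc m

-- Reversing the sweep word

reverse-concatMap : ∀ {A B : Set} (f : A → List B) xs → reverse (concatMap f xs) ≡ concatMap (reverse ∘ f) (reverse xs)
reverse-concatMap f []       = refl
reverse-concatMap f (x ∷ xs) = begin
  reverse (f x ++ concatMap f xs)
    ≡⟨ reverse-++ (f x) (concatMap f xs) ⟩
  reverse (concatMap f xs) ++ reverse (f x)
    ≡⟨ cong₂ _++_ (reverse-concatMap f xs) (sym (++-identityʳ _)) ⟩
  concatMap (reverse ∘ f) (reverse xs) ++ concatMap (reverse ∘ f) [ x ]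
    ≡⟨ concatMap-++ (reverse ∘ f) (reverse xs) [ x ] ⟨
  concatMap (reverse ∘ f) (reverse xs ∷ʳ x)
    ≡⟨ cong (concatMap (reverse ∘ f)) (unfold-reverse x xs) ⟨
  concatMap (reverse ∘ f) (reverse (x ∷ xs)) ∎
  where open ≡-Reasoning

reverse-letter : ∀ j x → reverse (letter j x) ≡ letter j x
reverse-letter j x with x ≡ᵇ j
... | true = refl
... | false with x ≡ᵇ suc j
... | true  = refl
... | false = refl

reverse-level : ∀ j s → reverse (level j s) ≡ level j (reverse s)
reverse-level j s = trans (reverse-concatMap (letter j) s) (concatMap-cong (reverse-letter j) (reverse s))

-- The deleted letter is an N in every case, so the N in front of the reversed word restores it. The
-- N in front of `u` moves behind `reverse u`, where it becomes the root letter of the extra 0.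
reverse-dropLast : ∀ u → NotE (reverse u) → N ∷ reverse (dropLast (N ∷ u)) ≡ reverse u ∷ʳ N
reverse-dropLast u p with initLast u
... | []      = refl
... | v ∷ʳ′ x rewrite reverse-++ v [ x ] | dropLast-∷ʳ (N ∷ v) x with x
...   | N = cong (N ∷_) (unfold-reverse N v)

-- Reversal makes the heights ascend, lets S⁺ read from the right and S⁻ from the left, and puts S⁺
-- before S⁻ at each height.
reverse-sweeps : ∀ T p q → Growing 0 (reverse p) → N ∷ reverse (sweeps T p q) ≡ levels (suc T) (reverse p) (0 ∷ q)
reverse-sweeps T p q g = begin
  N ∷ reverse (blocks T p q ++ level 0 (reverse q) ++ D)
    ≡⟨ cong (N ∷_) (reverse-++ (blocks T p q) _) ⟩
  N ∷ reverse (level 0 (reverse q) ++ D) ++ reverse (blocks T p q)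
    ≡⟨ cong (λ u → N ∷ u ++ reverse (blocks T p q)) (reverse-++ (level 0 (reverse q)) D) ⟩
  ((N ∷ reverse D) ++ reverse (level 0 (reverse q))) ++ reverse (blocks T p q)
    ≡⟨ cong₂ _++_ (cong₂ _++_ (reverse-dropLast (level 0 p) notE) (level-back 0 q)) reverse-blocks ⟩
  ((reverse (level 0 p) ∷ʳ N) ++ level 0 q) ++ concatMap block (applyUpTo suc T)
    ≡⟨ cong (_++ concatMap block (applyUpTo suc T)) (++-assoc (reverse (level 0 p)) [ N ] (level 0 q)) ⟩
  (reverse (level 0 p) ++ level 0 (0 ∷ q)) ++ concatMap block (applyUpTo suc T)
    ≡⟨ cong (λ u → (u ++ level 0 (0 ∷ q)) ++ concatMap block (applyUpTo suc T)) (reverse-level 0 p) ⟩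
  levels (suc T) (reverse p) (0 ∷ q) ∎
  where
  open ≡-Reasoning
  D = dropLast (N ∷ level 0 p)
  block block′ : ℕ → List Step
  block j  = level j (reverse p) ++ level j (0 ∷ q)
  block′ j = level j (reverse q) ++ level j p
  notE : NotE (reverse (level 0 p))
  notE = subst NotE (sym (reverse-level 0 p)) (notE-level₀ (reverse p) g)
  level-back : ∀ j s → reverse (level j (reverse s)) ≡ level j s
  level-back j s = trans (reverse-level j (reverse s)) (cong (level j) (reverse-involutive s))
  -- At heights above 0 the extra 0 yields no letter, so `level (suc j) (0 ∷ q)` computes to
  -- `level (suc j) q`.
  reverse-block : ∀ j → reverse (block′ (suc j)) ≡ block (suc j)
  reverse-block j = trans (reverse-++ (level (suc j) (reverse q)) (level (suc j) p))
    (cong₂ _++_ (reverse-level (suc j) p) (level-back (suc j) q))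
  reverse-blocks : reverse (blocks T p q) ≡ concatMap block (applyUpTo suc T)
  reverse-blocks = begin
    reverse (concatMap block′ (reverse (map suc (upTo T))))
      ≡⟨ reverse-concatMap block′ (reverse (map suc (upTo T))) ⟩
    concatMap (reverse ∘ block′) (reverse (reverse (map suc (upTo T))))
      ≡⟨ cong (concatMap (reverse ∘ block′)) (reverse-involutive (map suc (upTo T))) ⟩
    concatMap (reverse ∘ block′) (map suc (upTo T))
      ≡⟨ concatMap-map (reverse ∘ block′) suc (upTo T) ⟩
    concatMap (reverse ∘ block′ ∘ suc) (upTo T)
      ≡⟨ concatMap-cong reverse-block (upTo T) ⟩
    concatMap (block ∘ suc) (upTo T)
      ≡⟨ concatMap-map block suc (upTo T) ⟨
    concatMap block (map suc (upTo T))
      ≡⟨ cong (concatMap block) (map-upTo suc T) ⟩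
    concatMap block (applyUpTo suc T) ∎

-- Lattice paths and their heights

⊖-shift : ∀ a b d → (a ⊖ b) ℤ.+ + (b + d) ≡ + (a + d)
⊖-shift a b d = begin
  (a ⊖ b) ℤ.+ + (b + d)     ≡⟨ ℤ.distribˡ-⊖-+-pos (b + d) a b ⟩
  (a + (b + d)) ⊖ b         ≡⟨ cong₂ _⊖_ (lemma a b d) (sym (+-identityʳ b)) ⟩
  (b + (a + d)) ⊖ (b + 0)   ≡⟨ ℤ.+-cancelˡ-⊖ b (a + d) 0 ⟩
  + (a + d)                 ∎
  where
  open ≡-Reasoning
  lemma : ∀ a b d → a + (b + d) ≡ b + (a + d)
  lemma = solve-∀

-- Adding `b + d` to both sides clears the subtractions.
⊖-≤⁻ : ∀ a b c d → a ⊖ b ℤ.≤ c ⊖ d → a + d ≤ c + b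
⊖-≤⁻ a b c d p = ℤ.drop‿+≤+ (subst₂ ℤ._≤_ (⊖-shift a b d)
  (trans (cong (λ k → (c ⊖ d) ℤ.+ + k) (+-comm b d)) (⊖-shift c d b)) (ℤ.+-monoˡ-≤ (+ (b + d)) p))

⊖-≤⁺ : ∀ a b c d → a + d ≤ c + b → a ⊖ b ℤ.≤ c ⊖ d
⊖-≤⁺ a b c d p = begin
  a ⊖ b              ≡⟨ ℤ.+-cancelˡ-⊖ d a b ⟨
  (d + a) ⊖ (d + b)  ≤⟨ ℤ.⊖-monoˡ-≤ (d + b) (subst₂ _≤_ (+-comm a d) (+-comm c b) p) ⟩
  (b + c) ⊖ (d + b)  ≡⟨ cong ((b + c) ⊖_) (+-comm d b) ⟩
  (b + c) ⊖ (b + d)  ≡⟨ ℤ.+-cancelˡ-⊖ b c d ⟩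
  c ⊖ d              ∎
  where open ℤ.≤-Reasoning

suc-⊖-suc : ∀ c k → ℤ.suc (c ⊖ suc k) ≡ c ⊖ k
suc-⊖-suc c k = trans (ℤ.distribʳ-⊖-+-pos 1 c (suc k)) (ℤ.[1+m]⊖[1+n]≡m⊖n c k)

suc-negated : ∀ m → ℤ.suc (- + m) ≡ 1 ⊖ m
suc-negated = ℤ.m-n≡m⊖n 1

-- Heights after the North steps of a path that starts after c East and k North steps.
heights : ℕ → ℕ → List Step → List ℤ
heights c k []      = []
heights c k (N ∷ u) = (c ⊖ suc k) ∷ heights c (suc k) u
heights c k (E ∷ u) = heights (suc c) k u

length-heights : ∀ c k u → length (heights c k u) ≡ countN u
length-heights c k []      = refl
length-heights c k (N ∷ u) = cong suc (length-heights c (suc k) u)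
length-heights c k (E ∷ u) = length-heights (suc c) k u

heights-replicate-E : ∀ d c k u → heights c k (replicate d E ++ u) ≡ heights (d + c) k u
heights-replicate-E zero    c k u = refl
heights-replicate-E (suc d) c k u =
  trans (heights-replicate-E d (suc c) k u) (cong (λ c → heights c k u) (+-suc d c))

countN-replicate-E : ∀ d → countN (replicate d E) ≡ 0
countN-replicate-E zero    = refl
countN-replicate-E (suc d) = countN-replicate-E d

countE-replicate-E : ∀ d → countE (replicate d E) ≡ d
countE-replicate-E zero    = refl
countE-replicate-E (suc d) = cong suc (countE-replicate-E d)

heights-first : ∀ c k u → ∃[ d ] ∃[ a ] heights c k (u ∷ʳ N) ≡ ((d + c) ⊖ suc k) ∷ a
heights-first c k []      = 0 , _ , refl
heights-first c k (N ∷ u) = 0 , _ , refl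
heights-first c k (E ∷ u) with heights-first (suc c) k u
... | d , a , eq = suc d , a , trans eq (cong (λ c → (c ⊖ suc k) ∷ a) (+-suc d c))

-- An East step strictly raises the height recorded at the next North step, so the first height
-- tells whether a path begins with N or E.
heights-first-≢ : ∀ c k u {a} → heights (suc c) k (u ∷ʳ N) ≢ (c ⊖ suc k) ∷ a
heights-first-≢ c k u eq with heights-first (suc c) k u
... | d , _ , eq′ = <⇒≱ (m≤n+m (suc c) d) (+-cancelʳ-≤ (suc k) (d + suc c) c
  (⊖-≤⁻ (d + suc c) (suc k) c (suc k) (ℤ.≤-reflexive (∷-injectiveˡ (trans (sym eq′) eq)))))

heights-∷ʳ-≢[] : ∀ c k u → heights c k (u ∷ʳ N) ≢ []
heights-∷ʳ-≢[] c k u eq with heights-first c k u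
... | _ , _ , eq′ with () ← trans (sym eq) eq′

-- East steps after the last North step leave no trace in `heights`; the appended N makes all those
-- of `u` and `v` visible.
heights-injective : ∀ c k u v → heights c k (u ∷ʳ N) ≡ heights c k (v ∷ʳ N) → u ≡ v
heights-injective c k []      []      _  = refl
heights-injective c k []      (N ∷ v) eq = ⊥-elim (heights-∷ʳ-≢[] c (suc k) v (sym (∷-injectiveʳ eq)))
heights-injective c k []      (E ∷ v) eq = ⊥-elim (heights-first-≢ c k v (sym eq))
heights-injective c k (N ∷ u) []      eq = ⊥-elim (heights-∷ʳ-≢[] c (suc k) u (∷-injectiveʳ eq))
heights-injective c k (N ∷ u) (N ∷ v) eq = cong (N ∷_) (heights-injective c (suc k) u v (∷-injectiveʳ eq))
heights-injective c k (N ∷ u) (E ∷ v) eq = ⊥-elim (heights-first-≢ c k v (sym eq))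
heights-injective c k (E ∷ u) []      eq = ⊥-elim (heights-first-≢ c k u eq)
heights-injective c k (E ∷ u) (N ∷ v) eq = ⊥-elim (heights-first-≢ c k u eq)
heights-injective c k (E ∷ u) (E ∷ v) eq = cong (E ∷_) (heights-injective (suc c) k u v eq)

area-weaken : ∀ {h h′} a → h ℤ.≤ h′ → Area h′ a → Area h a
area-weaken []      p q       = ℤ.≤-trans p q
area-weaken (x ∷ a) p (q , v) = ℤ.≤-trans p q , v

-- Each North step lowers the height by one and East steps raise it. The numerical hypothesis says
-- that the last height, `c + countE u` minus `k + countN u + 1`, is at most `1 - m`.
heights-area : ∀ c k u m → m + (c + countE u) ≤ suc (suc (k + countN u)) →
  Area (c ⊖ k) (heights c k (u ∷ʳ N) ∷ʳ - + m)
heights-area c k [] m p =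
  ℤ.≤-reflexive (sym (suc-⊖-suc c k))
  , ℤ.≤-trans (⊖-≤⁺ c (suc k) 1 m (subst₂ _≤_ eq₁ eq₂ p)) (ℤ.≤-reflexive (sym (suc-negated m)))
  , ℤ.neg-≤-pos {m} {0}
  where
  eq₁ : m + (c + 0) ≡ c + m
  eq₁ = trans (cong (_+_ m) (+-identityʳ c)) (+-comm m c)
  eq₂ : suc (suc (k + 0)) ≡ 1 + suc k
  eq₂ = cong (λ k → suc (suc k)) (+-identityʳ k)
heights-area c k (N ∷ u) m p =
  ℤ.≤-reflexive (sym (suc-⊖-suc c k))
  , heights-area c (suc k) u m (subst (m + (c + countE u) ≤_) (cong (λ k → suc (suc k)) (+-suc k (countN u))) p)
heights-area c k (E ∷ u) m p =
  area-weaken (heights (suc c) k (u ∷ʳ N) ∷ʳ - + m) (ℤ.⊖-monoˡ-≤ k (n≤1+n c))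
    (heights-area (suc c) k u m (subst (_≤ suc (suc (k + countN u))) (cong (_+_ m) (+-suc c (countE u))) p))

-- The number `d` of East steps before the next North step is the slack in the inequality, taken as
-- an absolute value.
next-height : ∀ c k {y} → c ⊖ k ℤ.≤ ℤ.suc y → ∃[ d ] y ≡ (d + c) ⊖ suc k
next-height c k {y} p = d , (begin
  y                                ≡⟨ ℤ.pred-suc y ⟨
  ℤ.pred (ℤ.suc y)                 ≡⟨ cong ℤ.pred (ℤ.+-identityˡ (ℤ.suc y)) ⟨
  ℤ.pred (+ 0 ℤ.+ ℤ.suc y)         ≡⟨ cong (λ i → ℤ.pred (i ℤ.+ ℤ.suc y)) (ℤ.+-inverseʳ (c ⊖ k)) ⟨
  ℤ.pred (((c ⊖ k) ℤ.- (c ⊖ k)) ℤ.+ ℤ.suc y)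
    ≡⟨ cong ℤ.pred (lemma (c ⊖ k) (ℤ.suc y)) ⟩
  ℤ.pred ((ℤ.suc y ℤ.- (c ⊖ k)) ℤ.+ (c ⊖ k))
    ≡⟨ cong (λ i → ℤ.pred (i ℤ.+ (c ⊖ k))) (ℤ.0≤i⇒+∣i∣≡i (ℤ.i≤j⇒0≤j-i p)) ⟨
  ℤ.pred (+ d ℤ.+ (c ⊖ k))         ≡⟨ cong ℤ.pred (ℤ.distribʳ-⊖-+-pos d c k) ⟩
  ℤ.pred ((d + c) ⊖ k)             ≡⟨ ℤ.distribʳ-⊖-+-neg 0 (d + c) k ⟩
  (d + c) ⊖ suc k                  ∎)
  where
  open ≡-Reasoning
  d = ℤ.∣ ℤ.suc y ℤ.- (c ⊖ k) ∣
  lemma : ∀ i j → (i ℤ.- i) ℤ.+ j ≡ (j ℤ.- i) ℤ.+ i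
  lemma = ℤ-Solver.solve-∀

nonpositive-negated : ∀ {z} → z ℤ.≤ + 0 → ∃[ m ] z ≡ - + m
nonpositive-negated {+ zero}    _ = 0 , refl
nonpositive-negated { -[1+ m ]} _ = suc m , refl
nonpositive-negated {+ suc _}   (+≤+ ())

-- Every entry but the last becomes a run of East steps, of the length given by `next-height`,
-- closed by a North step. Two entries are demanded so that the N after `u` exists.
area-heights : ∀ c k y z a → Area (c ⊖ k) (y ∷ z ∷ a) →
  ∃[ u ] ∃[ m ] y ∷ z ∷ a ≡ heights c k (u ∷ʳ N) ∷ʳ - + m × m + (c + countE u) ≤ suc (suc (k + countN u))
area-heights c k y z a (p , v) with next-height c k {y} p
area-heights c k _ z [] (p , q , r) | d , refl with nonpositive-negated {z} r
... | m , refl = replicate d E , m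
  , cong (_∷ʳ - + m) (sym (heights-replicate-E d c k [ N ]))
  , subst₂ _≤_ eq₁ eq₂ (⊖-≤⁻ (d + c) (suc k) 1 m (ℤ.≤-trans q (ℤ.≤-reflexive (suc-negated m))))
  where
  eq₁ : (d + c) + m ≡ m + (c + countE (replicate d E))
  eq₁ = trans (+-comm (d + c) m) (cong (_+_ m) (trans (+-comm d c) (cong (_+_ c) (sym (countE-replicate-E d)))))
  eq₂ : 1 + suc k ≡ suc (suc (k + countN (replicate d E)))
  eq₂ = cong (λ k → suc (suc k)) (trans (sym (+-identityʳ k)) (cong (_+_ k) (sym (countN-replicate-E d))))
area-heights c k _ z (z′ ∷ a) (p , v) | d , refl with area-heights (d + c) (suc k) z z′ a v
... | u , m , eq , b = replicate d E ++ N ∷ u , m , eq₀ , subst₂ _≤_ eq₁ eq₂ b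
  where
  eq₀ : (d + c) ⊖ suc k ∷ z ∷ z′ ∷ a ≡ heights c k ((replicate d E ++ N ∷ u) ∷ʳ N) ∷ʳ - + m
  eq₀ = trans (cong ((d + c) ⊖ suc k ∷_) eq) (cong (_∷ʳ - + m) (sym
    (trans (cong (heights c k) (++-assoc (replicate d E) (N ∷ u) [ N ])) (heights-replicate-E d c k (N ∷ u ∷ʳ N)))))
  eq₁ : m + ((d + c) + countE u) ≡ m + (c + countE (replicate d E ++ N ∷ u))
  eq₁ rewrite countE-++ (replicate d E) (N ∷ u) | countE-replicate-E d =
    cong (_+_ m) (trans (cong (_+ countE u) (+-comm d c)) (+-assoc c d (countE u)))
  eq₂ : suc (suc (suc k + countN u)) ≡ suc (suc (k + countN (replicate d E ++ N ∷ u)))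
  eq₂ rewrite countN-++ (replicate d E) (N ∷ u) | countN-replicate-E d =
    cong (λ k → suc (suc k)) (sym (+-suc k (countN u)))

nth0-pisFrom : ∀ c u v → nth0 (pisFrom c (u ++ N ∷ v)) (countN u) ≡ c + countE u
nth0-pisFrom c []      v = sym (+-identityʳ c)
nth0-pisFrom c (N ∷ u) v = nth0-pisFrom c u v
nth0-pisFrom c (E ∷ u) v = trans (nth0-pisFrom (suc c) u v) (sym (+-suc c (countE u)))

applyUpTo-heights : ∀ c k u v (f : ℕ → ℤ) →
  (∀ i → i < countN u → f i ≡ + nth0 (pisFrom c (u ++ v)) i ℤ.- + suc (k + i)) →
  applyUpTo f (countN u) ≡ heights c k u
applyUpTo-heights c k []      v f h = refl
applyUpTo-heights c k (N ∷ u) v f h = cong₂ _∷_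
  (trans (h 0 (s≤s z≤n)) (trans (ℤ.m-n≡m⊖n c (suc (k + 0))) (cong (λ k → c ⊖ suc k) (+-identityʳ k))))
  (applyUpTo-heights c (suc k) u v (f ∘ suc) (λ i p → trans (h (suc i) (s≤s p))
    (cong (λ k → + nth0 (pisFrom c (u ++ v)) i ℤ.- + suc k) (+-suc k i))))
applyUpTo-heights c k (E ∷ u) v f h = applyUpTo-heights (suc c) k u v f h

<ᵇ-true : ∀ {m n} → m < n → (m <ᵇ n) ≡ true
<ᵇ-true {zero}  (s≤s _) = refl
<ᵇ-true {suc m} (s≤s p) = <ᵇ-true p

<ᵇ-irrefl : ∀ n → (n <ᵇ n) ≡ false
<ᵇ-irrefl zero    = refl
<ᵇ-irrefl (suc n) = <ᵇ-irrefl n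

muVec-heights : ∀ u v → muVec (suc (countN u)) (u ++ v) ≡ heights 0 0 u ∷ʳ muLast (suc (countN u)) (u ++ v)
muVec-heights u v = begin
  map μ (map suc (upTo n))            ≡⟨ cong (map μ) (map-upTo suc n) ⟩
  map μ (applyUpTo suc n)             ≡⟨ map-applyUpTo suc μ n ⟩
  applyUpTo (μ ∘ suc) n               ≡⟨ applyUpTo-∷ʳ (μ ∘ suc) (countN u) ⟨
  applyUpTo (μ ∘ suc) (countN u) ∷ʳ μ n ≡⟨ cong₂ _∷ʳ_ (applyUpTo-heights 0 0 u v (μ ∘ suc) before) last ⟩
  heights 0 0 u ∷ʳ muLast n (u ++ v)  ∎
  where
  open ≡-Reasoning
  n = suc (countN u)
  μ = muAt n (u ++ v)
  before : ∀ i → i < countN u → μ (suc i) ≡ + nth0 (pisFrom 0 (u ++ v)) i ℤ.- + suc i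
  before i p rewrite <ᵇ-true (s≤s p) = refl
  last : μ n ≡ muLast n (u ++ v)
  last rewrite <ᵇ-irrefl n = refl

-- The last two North steps and the last area entry

path : List Step → ℕ → ℕ → List Step
path u t r = u ++ N ∷ replicate t E ++ N ∷ replicate r E

countN-path : ∀ u t r → countN (path u t r) ≡ suc (suc (countN u))
countN-path u t r
  rewrite countN-++ u (N ∷ replicate t E ++ N ∷ replicate r E) | countN-++ (replicate t E) (N ∷ replicate r E)
        | countN-replicate-E t | countN-replicate-E r =
  trans (+-suc (countN u) 1) (cong suc (trans (+-suc (countN u) 0) (cong suc (+-identityʳ _))))

countE-path : ∀ u t r → countE (path u t r) ≡ countE u + (t + r)
countE-path u t r
  rewrite countE-++ u (N ∷ replicate t E ++ N ∷ replicate r E) | countE-++ (replicate t E) (N ∷ replicate r E)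
        | countE-replicate-E t | countE-replicate-E r = refl

last-N : ∀ w → 1 ≤ countN w → ∃[ u ] ∃[ r ] w ≡ u ++ N ∷ replicate r E
last-N (E ∷ w) p with last-N w p
... | u , r , refl = E ∷ u , r , refl
last-N (N ∷ w) p with countN w in eq
... | zero  = [] , countE w , cong (N ∷_) (only-E w eq)
  where
  only-E : ∀ w → countN w ≡ 0 → w ≡ replicate (countE w) E
  only-E []      _ = refl
  only-E (E ∷ w) p = cong (E ∷_) (only-E w p)
... | suc k with last-N w (subst (1 ≤_) (sym eq) (s≤s z≤n))
... | u , r , refl = N ∷ u , r , refl

path-exists : ∀ w → 2 ≤ countN w → ∃[ u ] ∃[ t ] ∃[ r ] w ≡ path u t r
path-exists w p with last-N w (≤-trans (s≤s z≤n) p)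
... | v , r , refl with last-N v (s≤s⁻¹ (subst (2 ≤_) eq p))
  where
  eq : countN (v ++ N ∷ replicate r E) ≡ suc (countN v)
  eq rewrite countN-++ v (N ∷ replicate r E) | countN-replicate-E r =
    trans (+-suc (countN v) 0) (cong suc (+-identityʳ _))
... | u , t , refl = u , t , r , ++-assoc u (N ∷ replicate t E) (N ∷ replicate r E)

piAt-path-prev : ∀ u t r → piAt (path u t r) (suc (countN u)) ≡ countE u
piAt-path-prev u t r = nth0-pisFrom 0 u _

piAt-path-last : ∀ u t r → piAt (path u t r) (suc (suc (countN u))) ≡ countE u + t
piAt-path-last u t r = begin
  nth0 (pisFrom 0 (path u t r)) (suc (countN u))
    ≡⟨ cong₂ (λ w i → nth0 (pisFrom 0 w) i) (++-assoc u (N ∷ replicate t E) _) countN-prefix ⟨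
  nth0 (pisFrom 0 ((u ++ N ∷ replicate t E) ++ N ∷ replicate r E)) (countN (u ++ N ∷ replicate t E))
    ≡⟨ nth0-pisFrom 0 (u ++ N ∷ replicate t E) (replicate r E) ⟩
  countE (u ++ N ∷ replicate t E)
    ≡⟨ trans (countE-++ u (N ∷ replicate t E)) (cong (_+_ (countE u)) (countE-replicate-E t)) ⟩
  countE u + t ∎
  where
  open ≡-Reasoning
  countN-prefix : countN (u ++ N ∷ replicate t E) ≡ suc (countN u)
  countN-prefix rewrite countN-++ u (N ∷ replicate t E) | countN-replicate-E t =
    trans (+-suc (countN u) 0) (cong suc (+-identityʳ _))

-- Neither the parity of the sum nor n mod 4 matters: the last area is always x or 1 - x, with x = t - r.
muLast-values : ∀ w {n e t r} → piAt w (n ∸ 1) ≡ e → piAt w n ≡ e + t → n ≡ e + (t + r) →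
  muLast n w ≡ t ⊖ r ⊎ muLast n w ≡ suc r ⊖ t
muLast-values w {n} {e} {t} {r} prev last eqn =
  go ((sum (map (piAt w) (map suc (upTo (n ∸ 2)))) % 2) ≡ᵇ 0) (((n % 4) ≡ᵇ 0) ∨ ((n % 4) ≡ᵇ 3)) prev last eqn
  where
  lemma₁ : ∀ e t r → ((+ 2) ℤ.* (e ℤ.+ t) ℤ.- e) ℤ.- (e ℤ.+ (t ℤ.+ r)) ≡ t ℤ.- r
  lemma₁ = ℤ-Solver.solve-∀
  lemma₂ : ∀ e t r → ((e ℤ.+ (t ℤ.+ r)) ℤ.+ + 1) ℤ.- ((+ 2) ℤ.* (e ℤ.+ t) ℤ.- e) ≡ (+ 1 ℤ.+ r) ℤ.- t
  lemma₂ = ℤ-Solver.solve-∀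
  lemma₃ : ∀ e t r → (((+ 2) ℤ.* (e ℤ.+ (t ℤ.+ r)) ℤ.+ + 1) ℤ.- (+ 2) ℤ.* (e ℤ.+ t) ℤ.+ e) ℤ.- (e ℤ.+ (t ℤ.+ r))
    ≡ (+ 1 ℤ.+ r) ℤ.- t
  lemma₃ = ℤ-Solver.solve-∀
  lemma₄ : ∀ e t r →
    ((e ℤ.+ (t ℤ.+ r)) ℤ.+ + 1) ℤ.- (((+ 2) ℤ.* (e ℤ.+ (t ℤ.+ r)) ℤ.+ + 1) ℤ.- (+ 2) ℤ.* (e ℤ.+ t) ℤ.+ e)
    ≡ t ℤ.- r
  lemma₄ = ℤ-Solver.solve-∀
  pos-2* : ∀ m → + (2 * m + 1) ≡ (+ 2) ℤ.* (+ m) ℤ.+ + 1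
  pos-2* m = cong (ℤ._+ + 1) (ℤ.pos-* 2 m)
  go : ∀ even direct {A B m} → B ≡ e → A ≡ e + t → m ≡ e + (t + r) →
    let l = if even then (+ 2) ℤ.* (+ A) ℤ.- (+ B) else (+ (2 * m + 1)) ℤ.- (+ 2) ℤ.* (+ A) ℤ.+ (+ B)
        x = if direct then l ℤ.- (+ m) else (+ (m + 1)) ℤ.- l
    in x ≡ t ⊖ r ⊎ x ≡ suc r ⊖ t
  go true  true  refl refl refl = inj₁ (trans (lemma₁ (+ e) (+ t) (+ r)) (ℤ.m-n≡m⊖n t r))
  go true  false refl refl refl = inj₂ (trans (lemma₂ (+ e) (+ t) (+ r)) (ℤ.m-n≡m⊖n (suc r) t))
  go false true  refl refl refl = inj₂ (trans
    (cong (λ i → (i ℤ.- (+ 2) ℤ.* (+ (e + t)) ℤ.+ (+ e)) ℤ.- (+ (e + (t + r)))) (pos-2* (e + (t + r))))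
    (trans (lemma₃ (+ e) (+ t) (+ r)) (ℤ.m-n≡m⊖n (suc r) t)))
  go false false refl refl refl = inj₁ (trans
    (cong (λ i → (+ ((e + (t + r)) + 1)) ℤ.- (i ℤ.- (+ 2) ℤ.* (+ (e + t)) ℤ.+ (+ e))) (pos-2* (e + (t + r))))
    (trans (lemma₄ (+ e) (+ t) (+ r)) (ℤ.m-n≡m⊖n t r)))

-- Fold t r m: of the two values t - r and 1 - (t - r), the one that is at most 0 is - m.
Fold : ℕ → ℕ → ℕ → Set
Fold t r m = r ≡ t + m ⊎ t ≡ r + suc m

fold-exists : ∀ t r → ∃[ m ] Fold t r m
fold-exists zero    r       = r , inj₁ refl
fold-exists (suc t) zero    = t , inj₂ refl
fold-exists (suc t) (suc r) with fold-exists t r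
... | m , inj₁ eq = m , inj₁ (cong suc eq)
... | m , inj₂ eq = m , inj₂ (cong suc eq)

fold-≤ : ∀ {t r m} → Fold t r m → m ≤ t + r
fold-≤ {t} {r} {m} (inj₁ refl) = ≤-trans (m≤n+m m t) (m≤n+m (t + m) t)
fold-≤ {t} {r} {m} (inj₂ refl) = ≤-trans (n≤1+n m) (≤-trans (m≤n+m (suc m) r) (m≤m+n (r + suc m) r))

double-injective : ∀ a b → a + a ≡ b + b → a ≡ b
double-injective zero    zero    _  = refl
double-injective (suc a) (suc b) eq =
  cong suc (double-injective a b (suc-injective (trans (sym (+-suc a a)) (trans (suc-injective eq) (+-suc b b)))))

double-≢-suc : ∀ a b → a + a ≢ suc (b + b)
double-≢-suc (suc a) (suc b) eq = double-≢-suc a b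
  (suc-injective (trans (sym (+-suc a a)) (trans (suc-injective eq) (cong suc (+-suc b b)))))
double-≢-suc (suc a) zero    eq with () ← trans (sym (+-suc a a)) (suc-injective eq)

double-+-suc : ∀ r m → (r + r) + suc m ≡ (r + suc m) + r
double-+-suc = solve-∀

-- The sum `t + r` is `t + t + m` in the first alternative and `r + r + suc m` in the second. The
-- parity of `t + r - m` therefore tells them apart, and the sum then determines both numbers.
fold-injective : ∀ {t r t′ r′ m} → Fold t r m → Fold t′ r′ m → t + r ≡ t′ + r′ → t ≡ t′ × r ≡ r′
fold-injective {t} {_} {t′} {_} {m} (inj₁ refl) (inj₁ refl) eq
  with refl ← double-injective t t′ (+-cancelʳ-≡ m _ _ (trans (+-assoc t t m) (trans eq (sym (+-assoc t′ t′ m)))))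
  = refl , refl
fold-injective {t} {_} {_} {r′} {m} (inj₁ refl) (inj₂ refl) eq =
  ⊥-elim (double-≢-suc t r′ (+-cancelʳ-≡ m _ _
    (trans (+-assoc t t m) (trans eq (trans (sym (double-+-suc r′ m)) (+-suc _ m))))))
fold-injective {_} {r} {t′} {_} {m} (inj₂ refl) (inj₁ refl) eq =
  ⊥-elim (double-≢-suc t′ r (+-cancelʳ-≡ m _ _
    (trans (+-assoc t′ t′ m) (trans (sym eq) (trans (sym (double-+-suc r m)) (+-suc _ m))))))
fold-injective {_} {r} {_} {r′} {m} (inj₂ refl) (inj₂ refl) eq
  with refl ← double-injective r r′ (+-cancelʳ-≡ (suc m) _ _
         (trans (double-+-suc r m) (trans eq (sym (double-+-suc r′ m)))))
  = refl , refl

-- The parity of `k` decides the alternative; raising both `t` and `r` by one keeps `m` and adds 2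
-- to the sum.
fold-surjective : ∀ k m → ∃[ t ] ∃[ r ] Fold t r m × t + r ≡ k + m
fold-surjective zero          m = 0 , m , inj₁ refl , refl
fold-surjective (suc zero)    m = suc m , 0 , inj₂ refl , +-identityʳ (suc m)
fold-surjective (suc (suc k)) m with fold-surjective k m
... | t , r , f , eq = suc t , suc r , suc-fold f , cong suc (trans (+-suc t r) (cong suc eq))
  where
  suc-fold : Fold t r m → Fold (suc t) (suc r) m
  suc-fold (inj₁ eq) = inj₁ (cong suc eq)
  suc-fold (inj₂ eq) = inj₂ (cong suc eq)

⊖-plus : ∀ t m → t ⊖ (t + m) ≡ - + m
⊖-plus t m = trans (cong (_⊖ (t + m)) (sym (+-identityʳ t)))
  (trans (ℤ.+-cancelˡ-⊖ t 0 m) (trans (sym (ℤ.m-n≡m⊖n 0 m)) (ℤ.+-identityˡ (- + m))))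

plus-⊖ : ∀ r m → (r + m) ⊖ r ≡ + m
plus-⊖ r m = trans (cong ((r + m) ⊖_) (sym (+-identityʳ r))) (ℤ.+-cancelˡ-⊖ r m 0)

fold-values : ∀ {t r m} → Fold t r m → ∀ {x} → x ≡ t ⊖ r ⊎ x ≡ suc r ⊖ t → x ≡ - + m ⊎ x ≡ + suc m
fold-values {t} {_} {m} (inj₁ refl) (inj₁ eq) = inj₁ (trans eq (⊖-plus t m))
fold-values {t} {_} {m} (inj₁ refl) (inj₂ eq) =
  inj₂ (trans eq (trans (cong (_⊖ t) (sym (+-suc t m))) (plus-⊖ t (suc m))))
fold-values {_} {r} {m} (inj₂ refl) (inj₁ eq) = inj₂ (trans eq (plus-⊖ r (suc m)))
fold-values {_} {r} {m} (inj₂ refl) (inj₂ eq) =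
  inj₁ (trans eq (trans (cong (suc r ⊖_) (+-suc r m)) (⊖-plus (suc r) m)))

-- Normalised area vectors of lattice paths

areas : List Step → ℕ → List ℤ
areas u m = heights 0 0 (u ∷ʳ N) ∷ʳ - + m

record Folded (n : ℕ) (w : List Step) : Set where
  constructor folded
  field
    {front}     : List Step
    {gap rest}  : ℕ
    {last}      : ℕ
    shape       : w ≡ path front gap rest
    fold        : Fold gap rest last
    countN-eq   : n ≡ suc (suc (countN front))
    countE-eq   : n ≡ countE front + (gap + rest)

folded-exists : ∀ {n w} → 2 ≤ n → InL n w → Folded n w
folded-exists {n} {w} n≥2 (cN , cE) with path-exists w (subst (2 ≤_) (sym cN) n≥2)
... | u , t , r , refl with fold-exists t r
... | m , f = folded refl f (trans (sym cN) (countN-path u t r)) (trans (sym cE) (countE-path u t r))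

∷ʳ-split : ∀ (u v : List Step) → u ++ N ∷ v ≡ (u ∷ʳ N) ++ v
∷ʳ-split u v = sym (++-assoc u [ N ] v)

-- The actual last area entry is `- + m` or `+ suc m`, and `sweeps-reflect` trades the second for
-- the first. It applies because `m` is at most `t + r`, hence at most `n`, which lies below
-- `2 * n`.
zetaB-folded : ∀ {n w} → (f : Folded n w) → let open Folded f in
  zetaB n w ≡ sweeps (2 * n) (nonneg (areas front last)) (nonpos (areas front last))
zetaB-folded {n} {w} (folded {u} {t} {r} {m} refl f refl eqE) =
  trans (zetaB≡sweeps n w) (trans (cong (λ a → sweeps (2 * n) (nonneg a) (nonpos a)) mu) reflect)
  where
  w₀ = path u t r
  countN-u∷ʳN : countN (u ∷ʳ N) ≡ suc (countN u)
  countN-u∷ʳN = countN-∷ʳ u N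
  mu : muVec n w₀ ≡ heights 0 0 (u ∷ʳ N) ∷ʳ muLast n w₀
  mu = subst₂ (λ w k → muVec (suc k) w ≡ heights 0 0 (u ∷ʳ N) ∷ʳ muLast (suc k) w)
    (sym (∷ʳ-split u (replicate t E ++ N ∷ replicate r E))) countN-u∷ʳN
    (muVec-heights (u ∷ʳ N) (replicate t E ++ N ∷ replicate r E))
  m<2n : m < 2 * n
  m<2n = ≤-trans (s≤s (≤-trans (fold-≤ f) (≤-trans (m≤n+m (t + r) (countE u)) (≤-reflexive (sym eqE)))))
    (≤-trans (≤-reflexive (+-comm 1 n)) (+-monoʳ-≤ n (s≤s z≤n)))
  h = heights 0 0 (u ∷ʳ N)
  reflect : sweeps (2 * n) (nonneg (h ∷ʳ muLast n w₀)) (nonpos (h ∷ʳ muLast n w₀))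
    ≡ sweeps (2 * n) (nonneg (areas u m)) (nonpos (areas u m))
  reflect with fold-values f (muLast-values w₀ (piAt-path-prev u t r) (piAt-path-last u t r) eqE)
  ... | inj₁ eq rewrite eq = refl
  ... | inj₂ eq rewrite eq = sweeps-reflect (heights 0 0 (u ∷ʳ N)) m<2n

area-areas : ∀ {n w} → (f : Folded n w) → let open Folded f in Area (+ 0) (areas front last)
area-areas (folded {u} {t} {r} {m} _ f eqN eqE) = heights-area 0 0 u m (begin
  m + countE u         ≤⟨ +-monoˡ-≤ (countE u) (fold-≤ f) ⟩
  (t + r) + countE u   ≡⟨ +-comm (t + r) (countE u) ⟩
  countE u + (t + r)   ≡⟨ trans (sym eqE) eqN ⟩
  suc (suc (countN u)) ∎)
  where open ≤-Reasoning

length-areas : ∀ u m → length (areas u m) ≡ suc (suc (countN u))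
length-areas u m = trans (length-++-comm (heights 0 0 (u ∷ʳ N)) [ - + m ])
  (cong suc (trans (length-heights 0 0 (u ∷ʳ N)) (countN-∷ʳ u N)))

-- Area vectors and ballot words

code : ℕ → List ℤ → List Step
code n a = sweeps (2 * n) (nonneg a) (nonpos a)

double≡ : ∀ n → 2 * n ≡ n + n
double≡ n = cong (_+_ n) (+-identityʳ n)

module Code {n a} (area : Area (+ 0) a) (size : length a ≡ n) where

  P Q : List ℕ
  P = reverse (nonneg a)
  Q = 0 ∷ nonpos a

  growingP : Growing 0 P
  growingP = growing-ʳ++ (nonneg a) (proj₁ (shrinking-nonneg a area)) tt

  n≤2n : n ≤ 2 * n
  n≤2n = m≤m+n n (n + 0)

  boundedP : Bounded (suc (2 * n)) P
  boundedP = bounded growingP (≤-trans (≤-reflexive (length-reverse (nonneg a)))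
    (≤-trans (length-nonneg a) (≤-trans (≤-reflexive size) (m≤n⇒m≤1+n n≤2n))))

  boundedQ : Bounded (suc (2 * n)) Q
  -- Started at height 0, the nonpositive entries grow from `bound (+ 0)`, which is 1; with the
  -- extra 0 in front the list grows from 0.
  boundedQ = bounded (z≤n , growing-nonpos a area)
    (s≤s (≤-trans (length-nonpos a) (≤-trans (≤-reflexive size) n≤2n)))

  word : List Step
  word = levels (suc (2 * n)) P Q

  reverse-code : N ∷ reverse (code n a) ≡ word
  reverse-code = reverse-sweeps (2 * n) (nonneg a) (nonpos a) growingP

  k : ℕ
  k = zeros (nonneg a)

  zerosP : zeros P ≡ k
  zerosP = zeros-reverse (nonneg a)

  zerosQ : zeros Q ≡ suc k
  zerosQ = cong suc (sym (zeros-nonneg a))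

  countN-word : countN word ≡ suc (n + k)
  countN-word = begin
    countN word                                ≡⟨ countN-levels (suc (2 * n)) boundedP boundedQ ⟩
    length P + suc (length (nonpos a))         ≡⟨ +-suc (length P) _ ⟩
    suc (length P + length (nonpos a))
      ≡⟨ cong (λ l → suc (l + length (nonpos a))) (length-reverse (nonneg a)) ⟩
    suc (length (nonneg a) + length (nonpos a)) ≡⟨ cong suc (length-nonneg-nonpos a) ⟩
    suc (length a + k)                         ≡⟨ cong (λ l → suc (l + k)) size ⟩
    suc (n + k)                                ∎
    where open ≡-Reasoning

  -- The surplus of N's over E's is the total number `k + suc k` of trees. Solved for `k`, this lets
  -- the word alone reveal how many trees each forest has.
  countE-word : countE word + k ≡ n
  countE-word = +-cancelˡ-≡ (suc k) _ _ (begin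
    suc k + (countE word + k)           ≡⟨ lemma k (countE word) ⟩
    k + (suc k + countE word)           ≡⟨ cong₂ (λ x y → x + (y + countE word)) zerosP zerosQ ⟨
    zeros P + (zeros Q + countE word)   ≡⟨ surplus-levels (suc (2 * n)) boundedP boundedQ ⟩
    countN word                         ≡⟨ countN-word ⟩
    suc (n + k)                         ≡⟨ cong suc (+-comm n k) ⟩
    suc k + n                           ∎)
    where
    open ≡-Reasoning
    lemma : ∀ k c → suc k + (c + k) ≡ k + (suc k + c)
    lemma = solve-∀

  code-inB : InB n (code n a)
  code-inB = suc-injective len
    , suffixBallot-reverse⇒ballot (code n a)
        (proj₂ (subst SuffixBallot (sym reverse-code) (levels-suffixBallot (suc (2 * n)) boundedP boundedQ)))
    where
    open ≡-Reasoning
    len : suc (length (code n a)) ≡ suc (2 * n)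
    len = begin
      suc (length (code n a))            ≡⟨ cong suc (length-reverse (code n a)) ⟨
      length (N ∷ reverse (code n a))    ≡⟨ cong length reverse-code ⟩
      length word                        ≡⟨ length≡countN+countE word ⟩
      countN word + countE word          ≡⟨ cong (_+ countE word) countN-word ⟩
      suc ((n + k) + countE word)        ≡⟨ cong suc (+-assoc n k (countE word)) ⟩
      suc (n + (k + countE word))
        ≡⟨ cong (λ l → suc (n + l)) (trans (+-comm k (countE word)) countE-word) ⟩
      suc (n + n)                        ≡⟨ cong suc (double≡ n) ⟨
      suc (2 * n)                        ∎

-- Equal words have equally many E's, hence equal `k`; then `levels-injective` recovers both forests
-- and `merge` the vector.
code-injective : ∀ {n a b} → Area (+ 0) a → Area (+ 0) b → length a ≡ n → length b ≡ n →
  code n a ≡ code n b → a ≡ b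
code-injective {n} {a} {b} va vb la lb eq =
  trans (sym (merge-nonneg-nonpos a va))
    (trans (cong₂ merge (reverse-injective (proj₁ same)) (∷-injectiveʳ (proj₂ same))) (merge-nonneg-nonpos b vb))
  where
  module A = Code va la
  module B = Code vb lb
  word≡ : A.word ≡ B.word
  word≡ = trans (sym A.reverse-code) (trans (cong (λ u → N ∷ reverse u) eq) B.reverse-code)
  k≡ : A.k ≡ B.k
  k≡ = +-cancelˡ-≡ (countE A.word) _ _
    (trans A.countE-word (trans (sym B.countE-word) (cong (λ u → countE u + B.k) (sym word≡))))
  same : A.P ≡ B.P × A.Q ≡ B.Q
  same = levels-injective (suc (2 * n)) A.boundedP A.boundedQ B.boundedP B.boundedQ
    (trans A.zerosP (trans k≡ (sym B.zerosP))) (trans A.zerosQ (trans (cong suc k≡) (sym B.zerosQ))) word≡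

inB-counts : ∀ {n u} → InB n u → ∃[ k ] countE u + k ≡ n × countN u ≡ countE u + (k + k)
inB-counts {n} {u} (len , bal) = n ∸ countE u , m+[n∸m]≡n e≤n , +-cancelˡ-≡ e _ _ (begin
  e + countN u          ≡⟨ +-comm e (countN u) ⟩
  countN u + e          ≡⟨ total ⟩
  n + n                 ≡⟨ cong₂ _+_ (m+[n∸m]≡n e≤n) (m+[n∸m]≡n e≤n) ⟨
  (e + (n ∸ e)) + (e + (n ∸ e)) ≡⟨ lemma e (n ∸ e) ⟩
  e + (e + ((n ∸ e) + (n ∸ e))) ∎)
  where
  open ≡-Reasoning
  e = countE u
  lemma : ∀ e k → (e + k) + (e + k) ≡ e + (e + (k + k))
  lemma = solve-∀
  total : countN u + e ≡ n + n
  total = trans (sym (length≡countN+countE u)) (trans len (double≡ n))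
  e≤countN : e ≤ countN u
  e≤countN = subst (λ v → countE v ≤ countN v) (take-all (length u) u ≤-refl) (bal (length u))
  e≤n : e ≤ n
  e≤n = *-cancelˡ-≤ 2 (subst₂ _≤_ (sym (double≡ e)) (trans total (sym (double≡ n))) (+-monoˡ-≤ e e≤countN))

code-surjective : ∀ {n u} → InB n u → ∃[ a ] Area (+ 0) a × length a ≡ n × code n a ≡ u
code-surjective {n} {u} inB@(len , bal) with inB-counts {n} {u} inB
... | k , eqE , eqN
  -- The additional N raises the surplus from `k + k` to `k + suc k`, the sum of the two numbers of
  -- trees, and keeps the word from beginning with E.
  with levels-surjective (suc (2 * n)) (N ∷ reverse u) k (suc k)
         (s≤s (≤-reflexive (trans (length-reverse u) len))) tt
         (≤-trans (suffixBallot-total (reverse u) sb) (n≤1+n _) , sb)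
         (begin
           suc (countN (reverse u))            ≡⟨ cong suc (countN-reverse u) ⟩
           suc (countN u)                      ≡⟨ cong suc eqN ⟩
           suc (countE u + (k + k))            ≡⟨ +-suc (countE u) (k + k) ⟨
           countE u + suc (k + k)              ≡⟨ cong (_+_ (countE u)) (+-suc k k) ⟨
           countE u + (k + suc k)              ≡⟨ cong (_+ (k + suc k)) (countE-reverse u) ⟨
           countE (reverse u) + (k + suc k)    ∎)
  where
  open ≡-Reasoning
  sb : SuffixBallot (reverse u)
  sb = ballot⇒suffixBallot-reverse u bal
-- The second forest has `suc k` trees, so its list is not empty and starts with a root: this is the
-- extra 0.
... | P , zero ∷ q , gP , (_ , gq) , zP , zQ , size , eq =
  a , area-merge p q shrink z≤n gq zpq
  , +-cancelʳ-≡ k _ _ (begin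
      length a + k                            ≡⟨ cong (_+_ (length a)) (trans (cong zeros nonneg≡) zp) ⟨
      length a + zeros (nonneg a)             ≡⟨ length-nonneg-nonpos a ⟨
      length (nonneg a) + length (nonpos a)   ≡⟨ cong₂ (λ x y → length x + length y) nonneg≡ nonpos≡ ⟩
      length p + length q                     ≡⟨ cong (_+ length q) (length-reverse P) ⟩
      length P + length q                     ≡⟨ suc-injective (trans (sym (+-suc (length P) (length q))) size) ⟩
      countN (reverse u)                      ≡⟨ countN-reverse u ⟩
      countN u                                ≡⟨ eqN ⟩
      countE u + (k + k)                      ≡⟨ +-assoc (countE u) k k ⟨
      (countE u + k) + k                      ≡⟨ cong (_+ k) eqE ⟩
      n + k                                   ∎)
  , reverse-injective (∷-injectiveʳ (begin
      N ∷ reverse (sweeps (2 * n) (nonneg a) (nonpos a))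
        ≡⟨ cong₂ (λ p q → N ∷ reverse (sweeps (2 * n) p q)) nonneg≡ nonpos≡ ⟩
      N ∷ reverse (sweeps (2 * n) p q)
        ≡⟨ reverse-sweeps (2 * n) p q (subst (Growing 0) (sym (reverse-involutive P)) gP) ⟩
      levels (suc (2 * n)) (reverse p) (0 ∷ q)
        ≡⟨ cong (λ P → levels (suc (2 * n)) P (0 ∷ q)) (reverse-involutive P) ⟩
      levels (suc (2 * n)) P (0 ∷ q)
        ≡⟨ eq ⟩
      N ∷ reverse u ∎))
  where
  open ≡-Reasoning
  p = reverse P
  a = merge p q
  shrink : Shrinking p
  shrink = shrinking-ʳ++ P gP tt
  zp : zeros p ≡ k
  zp = trans (zeros-reverse P) zP
  zpq : zeros p ≡ zeros q
  zpq = trans zp (sym (suc-injective zQ))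
  nonneg≡ : nonneg a ≡ p
  nonneg≡ = nonneg-merge p q zpq
  nonpos≡ : nonpos a ≡ q
  nonpos≡ = nonpos-merge p q zpq

-- The heights give `u`, the last entry gives `m`, and the number of East steps gives `t + r`, so
-- `fold-injective` applies.
folded-injective : ∀ {n w v} (f : Folded n w) (g : Folded n v) →
  areas (Folded.front f) (Folded.last f) ≡ areas (Folded.front g) (Folded.last g) → w ≡ v
folded-injective (folded {u} refl f _ eqE) (folded {u′} refl f′ _ eqE′) eq
  with eqH , eqM ← ∷ʳ-injective (heights 0 0 (u ∷ʳ N)) (heights 0 0 (u′ ∷ʳ N)) eq
  with refl ← heights-injective 0 0 u u′ eqH | refl ← ℤ.+-injective (ℤ.neg-injective eqM)
  with refl , refl ← fold-injective f f′ (+-cancelˡ-≡ (countE u) _ _ (trans (sym eqE) eqE′))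
  = refl

folded-surjective : ∀ {n} a → 2 ≤ n → Area (+ 0) a → length a ≡ n →
  ∃[ w ] InL n w × (∃[ f ] areas (Folded.front {n} {w} f) (Folded.last f) ≡ a)
folded-surjective []                        (s≤s _) _    ()
folded-surjective (_ ∷ [])                  2≤1     _    refl = ⊥-elim (1+n≰n 2≤1)
folded-surjective {n} (y ∷ z ∷ a) _ area size with area-heights 0 0 y z a area
-- The path needs `t + r = n - countE u`, so the first argument is this number minus `m`; by `b` the
-- subtraction does not truncate.
... | u , m , eq , b with fold-surjective (n ∸ (m + countE u)) m
... | t , r , f , eqT = path u t r , (trans (countN-path u t r) (sym eqN) , trans (countE-path u t r) (sym eqE))
  , folded refl f eqN eqE , sym eq
  where
  eqN : n ≡ suc (suc (countN u))
  eqN = trans (sym size) (trans (cong length eq) (length-areas u m))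
  eqE : n ≡ countE u + (t + r)
  eqE = begin
    n                                        ≡⟨ m∸n+n≡m (≤-trans b (≤-reflexive (sym eqN))) ⟨
    (n ∸ (m + countE u)) + (m + countE u)    ≡⟨ +-assoc (n ∸ (m + countE u)) m (countE u) ⟨
    ((n ∸ (m + countE u)) + m) + countE u    ≡⟨ cong (_+ countE u) eqT ⟨
    (t + r) + countE u                       ≡⟨ +-comm (t + r) (countE u) ⟩
    countE u + (t + r)                       ∎
    where open ≡-Reasoning

length-areas-folded : ∀ {n w} (f : Folded n w) → length (areas (Folded.front f) (Folded.last f)) ≡ n
length-areas-folded (folded {u} {last = m} _ _ eqN _) = trans (length-areas u m) (sym eqN)

theorem6p18 : (n : ℕ) → 2 ≤ n →
    ((w : List Step) → InL n w → InB n (zetaB n w))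
    × ((w v : List Step) → InL n w → InL n v → zetaB n w ≡ zetaB n v → w ≡ v)
    × ((u : List Step) → InB n u → ∃[ w ] (InL n w × zetaB n w ≡ u))
theorem6p18 n n≥2 = into , injective , surjective
  where
  into : (w : List Step) → InL n w → InB n (zetaB n w)
  into w w∈L = subst (InB n) (sym (zetaB-folded f)) (Code.code-inB (area-areas f) (length-areas-folded f))
    where
    f : Folded n w
    f = folded-exists n≥2 w∈L
  injective : (w v : List Step) → InL n w → InL n v → zetaB n w ≡ zetaB n v → w ≡ v
  injective w v w∈L v∈L eq = folded-injective f g
    (code-injective (area-areas f) (area-areas g) (length-areas-folded f) (length-areas-folded g)
      (trans (sym (zetaB-folded f)) (trans eq (zetaB-folded g))))
    where
    f : Folded n w
    f = folded-exists n≥2 w∈L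
    g : Folded n v
    g = folded-exists n≥2 v∈L
  surjective : (u : List Step) → InB n u → ∃[ w ] (InL n w × zetaB n w ≡ u)
  surjective u u∈B with code-surjective {n} {u} u∈B
  ... | a , area , size , eq with folded-surjective a n≥2 area size
  ... | w , w∈L , f , refl = w , w∈L , trans (zetaB-folded f) eq
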